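{- Let $\mathcal{H}=\{rrr,rrb\}$. Then, as $n\to\infty$, $h_2(n,\mathcal{H})=\Omega(\sqrt{n\log n})$ and $h_2(n,\mathcal{H})=O(\sqrt{n}\,\log^{3/2}n)$.
   Context: Edge-colorings of the complete graph $K_n$ use colors from $\{r,b,y\}$ (red, blue, yellow); they need not be proper, and not all colors need be used. A pattern is an edge-colored triangle, denoted by the multiset of the colors of its three edges; e.g. $rrr$ is the all-red triangle and $rrb$ is the triangle with two red edges and one blue edge. For a family $\mathcal{H}$ of patterns, $\operatorname{Forb}(n,\mathcal{H})$ is the set of all edge-colorings of $K_n$ with colors from $\{r,b,y\}$ in which no triangle has a coloring belonging to $\mathcal{H}$. For an edge-coloring $c$ of $K_n$, $h_2(c)$ is the maximum $k$ such that there is a set of $k$ vertices whose induced edges use at most two of the three colors. Finally, $h_2(n,\mathcal{H})=\min\{h_2(c): c\in\operatorname{Forb}(n,\mathcal{H})\}$. Here $\log$ is the base-2 logarithm. -}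

module Defs where

open import Data.Fin.Base using (Fin)
import Data.Fin.Properties as Fin
open import Data.Fin.Subset using (Subset; ∣_∣; ⊥) renaming (_∈_ to _∈ˢ_)
open import Data.Fin.Subset.Properties using (anySubset?; ∣p∣≤n; ∉⊥; ∣⊥∣≡0) renaming (_∈?_ to _∈ˢ?_)
open import Data.Integer.Base using (+_)
import Data.Integer.Base as ℤ
open import Data.List.Base using (List; []; _∷_; _++_)
open import Data.List.Membership.Propositional using (_∈_)
open import Data.List.Membership.Propositional.Properties using (∈-∃++)
open import Data.List.Relation.Binary.Permutation.Propositional
  using (_↭_; ↭-refl; ↭-sym; ↭-trans; prep)
open import Data.List.Relation.Binary.Permutation.Propositional.Properties
  using (∈-resp-↭; drop-mid; shift; ↭-empty-inv)
open import Data.List.Relation.Unary.Any as Any using (Any; here; there)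
open import Data.Nat.Base using (ℕ; zero; suc; _≤_; _<_; _^_)
import Data.Nat.Properties as ℕ
open import Data.Product.Base using (Σ; ∃; ∃-syntax; _×_; _,_; proj₁; proj₂)
open import Data.Rational.Unnormalised.Base as ℚᵘ
  using (ℚᵘ; mkℚᵘ; Positive; NonNegative; ↥_; ↧ₙ_)
open import Data.Sum.Base using (_⊎_; inj₁; inj₂)
open import Data.Vec.Base as Vec using (Vec; []; _∷_)
open import Data.Vec.Properties using (lookup∘tabulate)
open import Level using (0ℓ)
open import Relation.Binary.Definitions using (DecidableEquality)
open import Relation.Binary.PropositionalEquality
  using (_≡_; _≢_; refl; sym; trans; cong; subst)
open import Relation.Nullary.Decidable
  using (Dec; yes; no; map′; _×-dec_; _⊎-dec_; _→-dec_; ¬?)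
open import Relation.Nullary.Negation using (¬_; contradiction)
open import Relation.Unary using (Pred; Decidable)

------------------------------------------------------------------------
-- Extrema of sets of natural numbers

IsMaximum IsMinimum : Pred ℕ 0ℓ → ℕ → Set
IsMaximum P k = P k × (∀ m → P m → m ≤ k)
IsMinimum P k = P k × (∀ m → P m → k ≤ m)

minimum : ∀ {P : Pred ℕ 0ℓ} → Decidable P → ∃ P → ∃ (IsMinimum P)
minimum {P} P? (m , Pm) with search (suc m)
  where
  search : ∀ k → ∃ (IsMinimum P) ⊎ (∀ j → j < k → ¬ P j)
  search zero = inj₂ λ _ ()
  search (suc k) with search k
  ... | inj₁ found = inj₁ found
  ... | inj₂ none with P? k
  ...   | yes Pk = inj₁ (k , Pk , λ j Pj → ℕ.≮⇒≥ λ j<k → none j j<k Pj)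
  ...   | no ¬Pk = inj₂ λ j j<1+k Pj → case-≤ j (ℕ.m≤n⇒m<n∨m≡n (ℕ.≤-pred j<1+k)) Pj
    where
    case-≤ : ∀ j → j < k ⊎ j ≡ k → ¬ P j
    case-≤ j (inj₁ j<k) = none j j<k
    case-≤ j (inj₂ refl) = ¬Pk
... | inj₁ found = found
... | inj₂ none = contradiction Pm (none m ℕ.≤-refl)

maximum : ∀ {P : Pred ℕ 0ℓ} → Decidable P → ∃ P →
          ∀ bound → (∀ m → P m → m ≤ bound) → ∃ (IsMaximum P)
maximum {P} P? ∃P bound P≤ with P? bound
... | yes Pb = bound , Pb , P≤
maximum {P} P? (m , Pm) zero P≤ | no ¬P0 =
  contradiction (subst P (ℕ.n≤0⇒n≡0 (P≤ m Pm)) Pm) ¬P0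
maximum {P} P? ∃P (suc bound) P≤ | no ¬Pb =
  maximum P? ∃P bound λ m Pm →
    ℕ.≤-pred (ℕ.≤∧≢⇒< (P≤ m Pm) λ m≡b → ¬Pb (subst P m≡b Pm))

------------------------------------------------------------------------
-- Edge-colourings and patterns

data Color : Set where
  r b y : Color

-- The diagonal values of `color` carry no meaning: everything below
-- only looks at pairs of distinct vertices.
record Coloring (n : ℕ) : Set where
  constructor coloring
  field
    color     : Fin n → Fin n → Color
    color-sym : ∀ i j → color i j ≡ color j i

open Coloring public

-- A multiset of three colours, given by any listing of its elements.
record Pattern : Set where
  constructor pattern₃
  field
    c₁ c₂ c₃ : Color

infix 4 _~_

_~_ : Pattern → Pattern → Set
pattern₃ c₁ c₂ c₃ ~ pattern₃ d₁ d₂ d₃ = (c₁ ∷ c₂ ∷ c₃ ∷ []) ↭ (d₁ ∷ d₂ ∷ d₃ ∷ [])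

Family : Set
Family = List Pattern

triangle : ∀ {n} → Coloring n → (i j k : Fin n) → Pattern
triangle c i j k = pattern₃ (color c i j) (color c j k) (color c i k)

Forb : (n : ℕ) → Family → Coloring n → Set
Forb n H c = ∀ (i j k : Fin n) → i ≢ j → j ≢ k → i ≢ k →
             ¬ Any (triangle c i j k ~_) H

------------------------------------------------------------------------
-- The parameters h₂(c) and h₂(n, H)

AtMostTwoColors : ∀ {n} → Coloring n → Subset n → Set
AtMostTwoColors c S =
  ∃[ s ] ∃[ t ] ∀ i j → i ∈ˢ S → j ∈ˢ S → i ≢ j → color c i j ≡ s ⊎ color c i j ≡ t

TwoColoredSize : ∀ {n} → Coloring n → Pred ℕ 0ℓ
TwoColoredSize c k = ∃[ S ] ∣ S ∣ ≡ k × AtMostTwoColors c S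

-- Decision procedures, needed only to see that the extrema exist.
private
  infix 4 _≟_ _↭?_ _~?_ _≈_

  _≟_ : DecidableEquality Color
  r ≟ r = yes refl
  r ≟ b = no λ ()
  r ≟ y = no λ ()
  b ≟ r = no λ ()
  b ≟ b = yes refl
  b ≟ y = no λ ()
  y ≟ r = no λ ()
  y ≟ b = no λ ()
  y ≟ y = yes refl

  anyColor? : ∀ {P : Pred Color 0ℓ} → Decidable P → Dec (∃ P)
  anyColor? P? = map′
    (λ { (inj₁ p) → r , p ; (inj₂ (inj₁ p)) → b , p ; (inj₂ (inj₂ p)) → y , p })
    (λ { (r , p) → inj₁ p ; (b , p) → inj₂ (inj₁ p) ; (y , p) → inj₂ (inj₂ p) })
    (P? r ⊎-dec P? b ⊎-dec P? y)

  anyVec? : ∀ {A : Set} → (∀ {P : Pred A 0ℓ} → Decidable P → Dec (∃ P)) →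
            ∀ {n} {P : Pred (Vec A n) 0ℓ} → Decidable P → Dec (∃ P)
  anyVec? any? {zero} P? = map′ ([] ,_) (λ { ([] , p) → p }) (P? [])
  anyVec? any? {suc n} P? = map′
    (λ { (x , xs , p) → x ∷ xs , p })
    (λ { (x ∷ xs , p) → x , xs , p })
    (any? λ x → anyVec? any? λ xs → P? (x ∷ xs))

  _↭?_ : (xs ys : List Color) → Dec (xs ↭ ys)
  [] ↭? [] = yes ↭-refl
  [] ↭? (_ ∷ _) = no λ p → contradiction (↭-empty-inv (↭-sym p)) λ ()
  (x ∷ xs) ↭? ys with Any.any? (x ≟_) ys
  ... | no x∉ys = no λ p → x∉ys (∈-resp-↭ p (here refl))
  ... | yes x∈ys with ∈-∃++ x∈ys
  ...   | as , bs , refl = map′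
    (λ p → ↭-trans (prep x p) (↭-sym (shift x as bs)))
    (drop-mid [] as)
    (xs ↭? (as ++ bs))

  _~?_ : ∀ p q → Dec (p ~ q)
  pattern₃ _ _ _ ~? pattern₃ _ _ _ = _ ↭? _

  Forb? : ∀ {n} H → Decidable (Forb n H)
  Forb? H c = Fin.all? λ i → Fin.all? λ j → Fin.all? λ k →
    ¬? (i Fin.≟ j) →-dec ¬? (j Fin.≟ k) →-dec ¬? (i Fin.≟ k) →-dec
    ¬? (Any.any? (triangle c i j k ~?_) H)

  AtMostTwoColors? : ∀ {n} (c : Coloring n) → Decidable (AtMostTwoColors c)
  AtMostTwoColors? c S = anyColor? λ s → anyColor? λ t →
    Fin.all? λ i → Fin.all? λ j →
    (i ∈ˢ? S) →-dec (j ∈ˢ? S) →-dec ¬? (i Fin.≟ j) →-dec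
    (color c i j ≟ s ⊎-dec color c i j ≟ t)

  TwoColoredSize? : ∀ {n} (c : Coloring n) → Decidable (TwoColoredSize c)
  TwoColoredSize? c k = anySubset? λ S → (∣ S ∣ ℕ.≟ k) ×-dec AtMostTwoColors? c S

∃h₂ᶜ : ∀ {n} (c : Coloring n) → ∃ (IsMaximum (TwoColoredSize c))
∃h₂ᶜ {n} c = maximum (TwoColoredSize? c)
  (0 , ⊥ , ∣⊥∣≡0 n , r , r , λ _ _ i∈⊥ → contradiction i∈⊥ ∉⊥)
  n (λ { _ (S , refl , _) → ∣p∣≤n S })

h₂ᶜ : ∀ {n} → Coloring n → ℕ
h₂ᶜ c = proj₁ (∃h₂ᶜ c)

private
  _≈_ : ∀ {n} → Coloring n → Coloring n → Set
  c ≈ d = ∀ i j → color c i j ≡ color d i j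

  ≈-sym : ∀ {n} {c d : Coloring n} → c ≈ d → d ≈ c
  ≈-sym e i j = sym (e i j)

  Forb-resp : ∀ {n} H {c d : Coloring n} → c ≈ d → Forb n H c → Forb n H d
  Forb-resp H {c} {d} e f i j k i≢j j≢k i≢k a =
    f i j k i≢j j≢k i≢k (subst (λ t → Any (t ~_) H) (sym same) a)
    where
    same : triangle c i j k ≡ triangle d i j k
    same rewrite e i j | e j k | e i k = refl

  TwoColoredSize-resp : ∀ {n} {c d : Coloring n} → c ≈ d →
                        ∀ {k} → TwoColoredSize c k → TwoColoredSize d k
  TwoColoredSize-resp e (S , size , s , t , f) =
    S , size , s , t , λ i j i∈S j∈S i≢j →
      subst (λ x → x ≡ s ⊎ x ≡ t) (e i j) (f i j i∈S j∈S i≢j)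

  h₂ᶜ-resp : ∀ {n} {c d : Coloring n} → c ≈ d → h₂ᶜ c ≡ h₂ᶜ d
  h₂ᶜ-resp {n} {c} {d} e = ℕ.≤-antisym (mono {c} {d} e) (mono {d} {c} (≈-sym {c = c} {d} e))
    where
    mono : ∀ {c d : Coloring n} → c ≈ d → h₂ᶜ c ≤ h₂ᶜ d
    mono {c} {d} e =
      proj₂ (proj₂ (∃h₂ᶜ d)) _ (TwoColoredSize-resp {c = c} {d} e (proj₁ (proj₂ (∃h₂ᶜ c))))

  anyColoring? : ∀ {n} {P : Pred (Coloring n) 0ℓ} →
                 (∀ {c d} → c ≈ d → P c → P d) → Decidable P → Dec (∃ P)
  anyColoring? {n} {P} resp P? = map′
    (λ { (T , s , p) → coloring (entry T) s , p })
    (λ { (c , p) → table c ,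
         (λ i j → trans (lookup-table c i j)
                    (trans (color-sym c i j) (sym (lookup-table c j i)))) ,
         resp (λ i j → sym (lookup-table c i j)) p })
    (anyVec? (anyVec? anyColor?) good?)
    where
    entry : Vec (Vec Color n) n → Fin n → Fin n → Color
    entry T i j = Vec.lookup (Vec.lookup T i) j

    table : Coloring n → Vec (Vec Color n) n
    table c = Vec.tabulate λ i → Vec.tabulate (color c i)

    lookup-table : ∀ c i j → entry (table c) i j ≡ color c i j
    lookup-table c i j = trans
      (cong (λ row → Vec.lookup row j) (lookup∘tabulate (λ i → Vec.tabulate (color c i)) i))
      (lookup∘tabulate (color c i) j)

    Symmetric : Vec (Vec Color n) n → Set
    Symmetric T = ∀ i j → entry T i j ≡ entry T j i

    good? : Decidable (λ T → Σ (Symmetric T) λ s → P (coloring (entry T) s))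
    good? T with Fin.all? (λ i → Fin.all? λ j → entry T i j ≟ entry T j i)
    ... | no ¬s = no λ { (s , _) → ¬s s }
    ... | yes s = map′ (s ,_) (λ { (_ , p) → resp (λ _ _ → refl) p }) (P? (coloring (entry T) s))

h₂Value : (n : ℕ) → Family → Pred ℕ 0ℓ
h₂Value n H k = ∃[ c ] Forb n H c × h₂ᶜ c ≡ k

∃h₂ : ∀ n H → ∃ (Forb n H) → ∃ (IsMinimum (h₂Value n H))
∃h₂ n H (c , c∈Forb) = minimum
  (λ k → anyColoring?
    (λ {c} {d} e → λ { (f , eq) →
       Forb-resp H {c} {d} e f , trans (sym (h₂ᶜ-resp {c = c} {d} e)) eq })
    (λ c → Forb? H c ×-dec (h₂ᶜ c ℕ.≟ k)))
  (h₂ᶜ c , c , c∈Forb , refl)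

-- The minimum only makes sense when Forb(n, H) is nonempty; its value
-- does not depend on the witness.
h₂ : (n : ℕ) (H : Family) → ∃ (Forb n H) → ℕ
h₂ n H nonempty = proj₁ (∃h₂ n H nonempty)

rrr,rrb : Family
rrr,rrb = pattern₃ r r r ∷ pattern₃ r r b ∷ []

-- The all-yellow colouring.
rrr,rrb-avoidable : ∀ n → ∃ (Forb n rrr,rrb)
rrr,rrb-avoidable n = coloring (λ _ _ → y) (λ _ _ → refl) , λ _ _ _ _ _ _ →
  λ { (here p)         → y∉rrr (∈-resp-↭ p (here refl))
    ; (there (here p)) → y∉rrb (∈-resp-↭ p (here refl)) }
  where
  y∉rrr : ¬ y ∈ (r ∷ r ∷ r ∷ [])
  y∉rrr (there (there (there ())))

  y∉rrb : ¬ y ∈ (r ∷ r ∷ b ∷ [])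
  y∉rrb (there (there (there ())))

------------------------------------------------------------------------
-- Nonnegative reals

-- A real x ≥ 0 is represented by its lower cut { q ∈ ℚ : 0 ≤ q < x }
-- (so 0 is the empty cut).  Since x ≤ y iff every rational below x is
-- below y, the order is inclusion of cuts.
ℝ₊ : Set₁
ℝ₊ = Pred ℚᵘ 0ℓ

infix 4 _≼_
infixl 7 _·_

_≼_ : ℝ₊ → ℝ₊ → Set
x ≼ z = ∀ q → x q → z q

fromℚ : ℚᵘ → ℝ₊
fromℚ p q = NonNegative q × q ℚᵘ.< p

fromℕ : ℕ → ℝ₊
fromℕ n = fromℚ (mkℚᵘ (+ n) 0)

-- q < xz iff q ≤ st for some rationals 0 ≤ s < x and 0 ≤ t < z.
_·_ : ℝ₊ → ℝ₊ → ℝ₊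
(x · z) q = NonNegative q × ∃[ s ] ∃[ t ] x s × z t × q ℚᵘ.≤ s ℚᵘ.* t

√ : ℝ₊ → ℝ₊
√ x q = NonNegative q × x (q ℚᵘ.* q)

-- The real binary logarithm of n ≥ 1, without rounding:
-- p/d < log₂ n iff 2ᵖ < nᵈ.
log₂ : ℕ → ℝ₊
log₂ n q = NonNegative q × 2 ^ ℤ.∣ ↥ q ∣ < n ^ (↧ₙ q)

_^3/2 : ℝ₊ → ℝ₊
x ^3/2 = √ (x · x · x)

------------------------------------------------------------------------
-- Asymptotic notation, as n → ∞

infix 4 _∈O_ _∈Ω_

-- Requiring the constants to be rational loses no generality, since
-- a real constant may be enlarged (for O) or shrunk (for Ω).
_∈O_ _∈Ω_ : (ℕ → ℝ₊) → (ℕ → ℝ₊) → Set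
f ∈O g = ∃[ C ] Positive C × ∃[ N ] ∀ n → N ≤ n → f n ≼ fromℚ C · g n
f ∈Ω g = ∃[ c ] Positive c × ∃[ N ] ∀ n → N ≤ n → fromℚ c · g n ≼ f n

{-# OPTIONS --safe #-}

-- Lower bound, after Alon.  Red is triangle-free and red neighbourhoods are
-- yellow, so red has maximum degree and independence number at most h = h₂(c).
-- For a vertex v, charge an independent set W with D [v ∈ W] + |N(v) ∩ W|.  If
-- W is fixed outside v and N(v), so that x vertices of N(v) are available, it
-- has 2ˣ + 1 extensions, of average charge (D + x 2ˣ⁻¹) / (2ˣ + 1) ≥ c log D.
-- Summing over v gives c n log D ≤ (D + h) h, where D is a power of n or h.
--
-- Upper bound.  Take a random graph with edge probability 1/m for m ~ √n, make
-- an edge red unless its ends have a common neighbour smaller than both, then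
-- make the other pairs with a common neighbour yellow and the rest blue.  With
-- k ~ √n log n, in every k-set fewer than half of the pairs have a common
-- neighbour, so it contains blue.  A red-free k-set survives k²/4 successive
-- tests of probability 1/m, which is too unlikely for n^k sets.  A yellow-free
-- set induces a red matching, hence is the union of two red-free sets.

module Submission where

open import Defs
open import Data.Bool.Base using (Bool; true; false; _∧_; not)
import Data.Bool.Properties as Bool
open import Data.Fin.Base as Fin using (Fin; zero; suc)
import Data.Fin.Properties as Fin
open import Data.Fin.Subset using (Subset; ∣_∣)
import Data.Integer.Base as ℤ
import Data.Integer.Properties as ℤ
open import Data.List.Base using (List; []; _∷_; _++_; map; concatMap; length; filter; allFin; replicate)
open import Data.List.Membership.Propositional using (_∈_; _∉_)
open import Data.List.Membership.Propositional.Properties using (∈-filter⁺; ∈-filter⁻; ∈-allFin)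
open import Data.List.Properties using (map-tabulate; length-tabulate; length-replicate)
open import Data.List.Relation.Binary.Permutation.Propositional using (↭-refl)
open import Data.List.Relation.Binary.Permutation.Propositional.Properties using (map⁺)
open import Data.List.Relation.Unary.All as All using ([]; _∷_)
open import Data.List.Relation.Unary.AllPairs using ([]; _∷_)
open import Data.List.Relation.Unary.Any using (Any; here; there)
open import Data.List.Relation.Unary.Unique.Propositional using (Unique)
open import Data.List.Relation.Unary.Unique.Propositional.Properties using (allFin⁺; filter⁺)
open import Data.Nat.Base
open import Data.Nat.ListAction using (sum)
open import Data.Nat.ListAction.Properties using (sum-↭)
open import Data.Nat.Properties
open import Data.Nat.Tactic.RingSolver using (solve-∀)
open import Data.Product.Base using (∃; _×_; _,_; proj₁; proj₂)
open import Data.Rational.Unnormalised.Base as ℚᵘ using (ℚᵘ; mkℚᵘ; NonNegative; *<*; *≤*; *≡*)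
import Data.Rational.Unnormalised.Properties as ℚᵘ
open import Data.Sum.Base using (_⊎_; inj₁; inj₂; [_,_]′; swap)
open import Data.Unit.Base using (tt)
open import Data.Vec.Base as Vec using (Vec; []; _∷_; lookup; _[_]≔_)
open import Data.Vec.Properties
  using (lookup∘tabulate; lookup-replicate; lookup∘update; lookup∘update′; []=⇒lookup; lookup⇒[]=)
open import Function.Base using (_∘_; id)
open import Function.Bundles using (mk⇔)
open import Relation.Binary.Definitions using (tri<; tri≈; tri>)
open import Relation.Binary.PropositionalEquality
open import Relation.Nullary.Decidable
  using (Dec; yes; no; does; _×-dec_; _→-dec_; _⊎-dec_; ¬?; does-⇔; dec-true)
open import Relation.Nullary.Negation using (¬_; contradiction)

-- Finite sums and products

-- The vertex order makes the random coloring tractable. Whether a pair may still become red is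
-- decided by rows before that of its smaller vertex, where its bit lies. So each test reads a fresh
-- bit, and the failure probabilities multiply although the set of tests is itself random. Yellow
-- uses all common neighbours, because the middle vertex of a red path may exceed both ends. In a
-- blue-free k-set all pairs without a common neighbour would be edges, and a k-set spans too few
-- edges for that.
--
-- In the lower bound D is chosen twice. A power of two of order √n gives h > D, since h ≤ D would
-- imply n ≤ 2D². Then D = h is itself large enough, and n ℓ ≤ 2h² follows with ℓ of order log n. No
-- logarithm of the number 2ˣ of extensions is taken: x 2ˣ ≥ t 2ˣ - 2ᵗ is linear in that number and
-- holds for every t.
--
-- Probabilities are counts in a list of matrices with multiplicities, so every estimate is an
-- inequality in ℕ cleared of denominators.

⟦_⟧ : Bool → ℕ
⟦ true ⟧ = 1
⟦ false ⟧ = 0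

𝟙 : ∀ {P : Set} → Dec P → ℕ
𝟙 P? = ⟦ does P? ⟧

⟦⟧≤1 : ∀ a → ⟦ a ⟧ ≤ 1
⟦⟧≤1 true = ≤-refl
⟦⟧≤1 false = z≤n

𝟙-yes : ∀ {P : Set} (P? : Dec P) → P → 𝟙 P? ≡ 1
𝟙-yes (yes _) _ = refl
𝟙-yes (no ¬p) p = contradiction p ¬p

𝟙-no : ∀ {P : Set} (P? : Dec P) → ¬ P → 𝟙 P? ≡ 0
𝟙-no (yes p) ¬p = contradiction p ¬p
𝟙-no (no _) _ = refl

𝟙≡0⇒¬ : ∀ {P : Set} (P? : Dec P) → 𝟙 P? ≡ 0 → ¬ P
𝟙≡0⇒¬ (no ¬p) _ = ¬p

𝟙*≤ : ∀ {P : Set} (P? : Dec P) {a c} → (P → a ≤ c) → 𝟙 P? * a ≤ c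
𝟙*≤ (yes p) {a} h = ≤-trans (≤-reflexive (*-identityˡ a)) (h p)
𝟙*≤ (no _) h = z≤n

𝟙≤ : ∀ {P : Set} (P? : Dec P) {c} → (P → 1 ≤ c) → 𝟙 P? ≤ c
𝟙≤ (yes p) h = h p
𝟙≤ (no _) h = z≤n

module _ {A : Set} where

  ∑ : List A → (A → ℕ) → ℕ
  ∑ [] f = 0
  ∑ (x ∷ xs) f = f x + ∑ xs f

  ∑-cong : ∀ xs {f g : A → ℕ} → (∀ x → f x ≡ g x) → ∑ xs f ≡ ∑ xs g
  ∑-cong [] h = refl
  ∑-cong (x ∷ xs) h = cong₂ _+_ (h x) (∑-cong xs h)

  ∑-mono : ∀ xs {f g : A → ℕ} → (∀ x → f x ≤ g x) → ∑ xs f ≤ ∑ xs g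
  ∑-mono [] h = z≤n
  ∑-mono (x ∷ xs) h = +-mono-≤ (h x) (∑-mono xs h)

  ∑-+ : ∀ xs (f g : A → ℕ) → ∑ xs (λ x → f x + g x) ≡ ∑ xs f + ∑ xs g
  ∑-+ [] f g = refl
  ∑-+ (x ∷ xs) f g rewrite ∑-+ xs f g = lemma (f x) (g x) (∑ xs f) (∑ xs g)
    where
    lemma : ∀ a c d e → a + c + (d + e) ≡ a + d + (c + e)
    lemma = solve-∀

  ∑-*ˡ : ∀ xs c (f : A → ℕ) → ∑ xs (λ x → c * f x) ≡ c * ∑ xs f
  ∑-*ˡ [] c f = sym (*-zeroʳ c)
  ∑-*ˡ (x ∷ xs) c f rewrite ∑-*ˡ xs c f = sym (*-distribˡ-+ c (f x) (∑ xs f))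

  ∑-*ʳ : ∀ xs c (f : A → ℕ) → ∑ xs (λ x → f x * c) ≡ ∑ xs f * c
  ∑-*ʳ xs c f = trans (∑-cong xs λ x → *-comm (f x) c) (trans (∑-*ˡ xs c f) (*-comm c _))

  ∑-const : ∀ xs c → ∑ xs (λ _ → c) ≡ length xs * c
  ∑-const [] c = refl
  ∑-const (x ∷ xs) c = cong (c +_) (∑-const xs c)

  ∑-++ : ∀ xs ys (f : A → ℕ) → ∑ (xs ++ ys) f ≡ ∑ xs f + ∑ ys f
  ∑-++ [] ys f = refl
  ∑-++ (x ∷ xs) ys f = trans (cong (f x +_) (∑-++ xs ys f)) (sym (+-assoc (f x) _ _))

  ∑-replicate : ∀ q a (f : A → ℕ) → ∑ (replicate q a) f ≡ q * f a
  ∑-replicate zero a f = refl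
  ∑-replicate (suc q) a f = cong (f a +_) (∑-replicate q a f)

  ∑-filter : ∀ {P : A → Set} (P? : ∀ a → Dec (P a)) xs (f : A → ℕ) →
             ∑ (filter P? xs) f ≡ ∑ xs (λ x → 𝟙 (P? x) * f x)
  ∑-filter P? [] f = refl
  ∑-filter P? (x ∷ xs) f with P? x
  ... | yes _ = cong₂ _+_ (sym (*-identityˡ (f x))) (∑-filter P? xs f)
  ... | no _ = ∑-filter P? xs f

  -- The first-moment method in counting form: applied to the number of bad events, it yields a
  -- matrix with none.
  ∑<length⇒∃0 : ∀ xs (f : A → ℕ) → ∑ xs f < length xs → ∃ λ x → f x ≡ 0
  ∑<length⇒∃0 (x ∷ xs) f h with f x in eq
  ... | zero = x , eq
  ... | suc k = ∑<length⇒∃0 xs f (≤-trans (s≤s (m≤n+m _ k)) (s≤s⁻¹ h))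

module _ {A B : Set} where

  ∑-swap : ∀ (xs : List A) (ys : List B) (f : A → B → ℕ) →
           ∑ xs (λ x → ∑ ys (f x)) ≡ ∑ ys (λ z → ∑ xs (λ x → f x z))
  ∑-swap [] ys f = sym (trans (∑-const ys 0) (*-zeroʳ (length ys)))
  ∑-swap (x ∷ xs) ys f =
    trans (cong (∑ ys (f x) +_) (∑-swap xs ys f)) (sym (∑-+ ys (f x) _))

  ∑-map : ∀ (g : A → B) xs (f : B → ℕ) → ∑ (map g xs) f ≡ ∑ xs (f ∘ g)
  ∑-map g [] f = refl
  ∑-map g (x ∷ xs) f = cong (f (g x) +_) (∑-map g xs f)

  ∑-concatMap : ∀ (g : A → List B) xs (f : B → ℕ) → ∑ (concatMap g xs) f ≡ ∑ xs (λ x → ∑ (g x) f)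
  ∑-concatMap g [] f = refl
  ∑-concatMap g (x ∷ xs) f =
    trans (∑-++ (g x) (concatMap g xs) f) (cong (∑ (g x) f +_) (∑-concatMap g xs f))

∑-length : ∀ {A : Set} (xs : List A) → ∑ xs (λ _ → 1) ≡ length xs
∑-length xs = trans (∑-const xs 1) (*-identityʳ _)

∑ᶠ : ∀ {n} → (Fin n → ℕ) → ℕ
∑ᶠ f = ∑ (allFin _) f

∑ᶠ-suc : ∀ {n} (f : Fin (suc n) → ℕ) → ∑ᶠ f ≡ f zero + ∑ᶠ (f ∘ suc)
∑ᶠ-suc {n} f = cong (f zero +_)
  (trans (cong (λ l → ∑ l f) (sym (map-tabulate id suc))) (∑-map suc (allFin n) f))

∑ᶠ-const : ∀ {n} c → ∑ᶠ {n} (λ _ → c) ≡ n * c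
∑ᶠ-const {n} c = trans (∑-const (allFin n) c) (cong (_* c) (length-tabulate {n = n} id))

∑ᶠ-≥ : ∀ {n} (f : Fin n → ℕ) i → f i ≤ ∑ᶠ f
∑ᶠ-≥ f zero = ≤-trans (m≤m+n _ _) (≤-reflexive (sym (∑ᶠ-suc f)))
∑ᶠ-≥ f (suc i) = ≤-trans (∑ᶠ-≥ (f ∘ suc) i)
  (≤-trans (m≤n+m _ (f zero)) (≤-reflexive (sym (∑ᶠ-suc f))))

∏ : ∀ {n} → (Fin n → ℕ) → ℕ
∏ {zero} f = 1
∏ {suc n} f = f zero * ∏ (f ∘ suc)

∏-cong : ∀ {n} {f g : Fin n → ℕ} → (∀ i → f i ≡ g i) → ∏ f ≡ ∏ g
∏-cong {zero} h = refl
∏-cong {suc n} h = cong₂ _*_ (h zero) (∏-cong (h ∘ suc))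

∏-* : ∀ {n} (f g : Fin n → ℕ) → ∏ (λ i → f i * g i) ≡ ∏ f * ∏ g
∏-* {zero} f g = refl
∏-* {suc n} f g rewrite ∏-* (f ∘ suc) (g ∘ suc) = lemma (f zero) (g zero) _ _
  where
  lemma : ∀ a c d e → a * c * (d * e) ≡ a * d * (c * e)
  lemma = solve-∀

∏-^ : ∀ {n} c (f : Fin n → ℕ) → ∏ (λ i → c ^ f i) ≡ c ^ ∑ᶠ f
∏-^ {zero} c f = refl
∏-^ {suc n} c f = trans (cong (c ^ f zero *_) (∏-^ c (f ∘ suc)))
  (trans (sym (^-distribˡ-+-* c (f zero) _)) (cong (c ^_) (sym (∑ᶠ-suc f))))

∏-const : ∀ n c → ∏ {n} (λ _ → c) ≡ c ^ n
∏-const zero c = refl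
∏-const (suc n) c = cong (c *_) (∏-const n c)

module _ {A : Set} where

  vectors : List A → ∀ n → List (Vec A n)
  vectors xs zero = [] ∷ []
  vectors xs (suc n) = concatMap (λ a → map (a ∷_) (vectors xs n)) xs

  ∑-vectors-suc : ∀ xs n (f : Vec A (suc n) → ℕ) →
                  ∑ (vectors xs (suc n)) f ≡ ∑ xs λ a → ∑ (vectors xs n) λ v → f (a ∷ v)
  ∑-vectors-suc xs n f = trans (∑-concatMap _ xs f)
    (∑-cong xs λ a → ∑-map (a ∷_) (vectors xs n) f)

  length-vectors : ∀ xs n → length (vectors xs n) ≡ length xs ^ n
  length-vectors xs zero = refl
  length-vectors xs (suc n) = begin
    length (vectors xs (suc n))            ≡⟨ ∑-length (vectors xs (suc n)) ⟨
    ∑ (vectors xs (suc n)) (λ _ → 1)       ≡⟨ ∑-vectors-suc xs n _ ⟩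
    ∑ xs (λ _ → ∑ (vectors xs n) λ _ → 1)  ≡⟨ ∑-const xs _ ⟩
    length xs * ∑ (vectors xs n) (λ _ → 1)
      ≡⟨ cong (length xs *_) (trans (∑-length (vectors xs n)) (length-vectors xs n)) ⟩
    length xs * length xs ^ n              ∎
    where open ≡-Reasoning

  -- The i-th factor may depend on the entries before i: averaging out the
  -- entries from the last to the first bounds each factor in turn.
  Causal : ∀ {n} → (Vec A n → Fin n → A → ℕ) → Set
  Causal g = ∀ v w i → (∀ j → j Fin.< i → lookup v j ≡ lookup w j) → ∀ a → g v i a ≡ g w i a

  ∑-causal-∏ : A → ∀ xs {n} (g : Vec A n → Fin n → A → ℕ) (B : Fin n → ℕ) → Causal g →
               (∀ v i → ∑ xs (g v i) ≤ B i) →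
               ∑ (vectors xs n) (λ v → ∏ λ i → g v i (lookup v i)) ≤ ∏ B
  ∑-causal-∏ a₀ xs {zero} g B causal bound = ≤-refl
  ∑-causal-∏ a₀ xs {suc n} g B causal bound = begin
    ∑ (vectors xs (suc n)) (λ v → ∏ λ i → g v i (lookup v i))
      ≡⟨ ∑-vectors-suc xs n _ ⟩
    ∑ xs (λ a → ∑ (vectors xs n) λ v → g (a ∷ v) zero a * ∏ λ i → g (a ∷ v) (suc i) (lookup v i))
      ≡⟨ ∑-cong xs (λ a → trans
           (∑-cong (vectors xs n) λ v → cong (_* ∏ λ i → g (a ∷ v) (suc i) (lookup v i))
             (causal (a ∷ v) ref zero (λ _ ()) a))
           (∑-*ˡ (vectors xs n) (g ref zero a) _)) ⟩
    ∑ xs (λ a → g ref zero a * ∑ (vectors xs n) λ v → ∏ λ i → g (a ∷ v) (suc i) (lookup v i))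
      ≤⟨ ∑-mono xs (λ a → *-monoʳ-≤ (g ref zero a)
           (∑-causal-∏ a₀ xs (λ v i → g (a ∷ v) (suc i)) (B ∘ suc)
             (λ v w i eq → causal (a ∷ v) (a ∷ w) (suc i)
               λ { zero _ → refl ; (suc j) j<i → eq j (s≤s⁻¹ j<i) })
             λ v i → bound (a ∷ v) (suc i))) ⟩
    ∑ xs (λ a → g ref zero a * ∏ (B ∘ suc))
      ≡⟨ ∑-*ʳ xs _ _ ⟩
    ∑ xs (g ref zero) * ∏ (B ∘ suc)
      ≤⟨ *-monoˡ-≤ _ (bound ref zero) ⟩
    ∏ B ∎
    where
    open ≤-Reasoning
    ref = Vec.replicate (suc n) a₀

-- Independent sets in triangle-free graphs

t<2^t : ∀ t → t < 2 ^ t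
t<2^t zero = ≤-refl
t<2^t (suc t) = +-mono-≤ (m^n>0 2 t) (≤-trans (t<2^t t) (m≤m+n _ 0))

subsets : ∀ n → List (Vec Bool n)
subsets = vectors (true ∷ false ∷ [])

size : ∀ {n} → Vec Bool n → ℕ
size W = ∑ᶠ λ i → ⟦ lookup W i ⟧

∑-subsets-suc : ∀ {n} (f : Vec Bool (suc n) → ℕ) → ∑ (subsets (suc n)) f ≡
                ∑ (subsets n) (f ∘ (true ∷_)) + ∑ (subsets n) (f ∘ (false ∷_))
∑-subsets-suc {n} f = trans (∑-vectors-suc (true ∷ false ∷ []) n f)
  (cong (∑ (subsets n) (f ∘ (true ∷_)) +_) (+-identityʳ _))

≤∑-subsets : ∀ {n} (f : Vec Bool n → ℕ) W → f W ≤ ∑ (subsets n) f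
≤∑-subsets f [] = m≤m+n (f []) 0
≤∑-subsets f (true ∷ W) = ≤-trans (≤∑-subsets (f ∘ (true ∷_)) W)
  (≤-trans (m≤m+n _ _) (≤-reflexive (sym (∑-subsets-suc f))))
≤∑-subsets f (false ∷ W) = ≤-trans (≤∑-subsets (f ∘ (false ∷_)) W)
  (≤-trans (m≤n+m _ _) (≤-reflexive (sym (∑-subsets-suc f))))

-- Each set is reached from exactly two W, those that agree with it off u.
∑-update : ∀ {n} (u : Fin n) (f : Vec Bool n → ℕ) →
           ∑ (subsets n) (λ W → f (W [ u ]≔ true) + f (W [ u ]≔ false)) ≡ 2 * ∑ (subsets n) f
∑-update {suc n} zero f = begin
  ∑ (subsets (suc n)) g     ≡⟨ ∑-subsets-suc g ⟩
  S + S                     ≡⟨ cong (S +_) (+-identityʳ S) ⟨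
  2 * S                     ≡⟨ cong (2 *_) (trans (∑-+ (subsets n) _ _) (sym (∑-subsets-suc f))) ⟩
  2 * ∑ (subsets (suc n)) f ∎
  where
  open ≡-Reasoning
  g : Vec Bool (suc n) → ℕ
  g W = f (W [ zero ]≔ true) + f (W [ zero ]≔ false)
  S = ∑ (subsets n) λ W → f (true ∷ W) + f (false ∷ W)
∑-update {suc n} (suc u) f = begin
  ∑ (subsets (suc n)) g
    ≡⟨ ∑-subsets-suc g ⟩
  ∑ (subsets n) (g ∘ (true ∷_)) + ∑ (subsets n) (g ∘ (false ∷_))
    ≡⟨ cong₂ _+_ (∑-update u (f ∘ (true ∷_))) (∑-update u (f ∘ (false ∷_))) ⟩
  2 * ∑ (subsets n) (f ∘ (true ∷_)) + 2 * ∑ (subsets n) (f ∘ (false ∷_))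
    ≡⟨ *-distribˡ-+ 2 (∑ (subsets n) (f ∘ (true ∷_))) _ ⟨
  2 * (∑ (subsets n) (f ∘ (true ∷_)) + ∑ (subsets n) (f ∘ (false ∷_)))
    ≡⟨ cong (2 *_) (∑-subsets-suc f) ⟨
  2 * ∑ (subsets (suc n)) f ∎
  where
  open ≡-Reasoning
  g : Vec Bool (suc n) → ℕ
  g W = f (W [ suc u ]≔ true) + f (W [ suc u ]≔ false)

module _ {n : ℕ} where

  assignments : List (Fin n) → Vec Bool n → List (Vec Bool n)
  assignments [] W = W ∷ []
  assignments (u ∷ us) W = assignments us (W [ u ]≔ true) ++ assignments us (W [ u ]≔ false)

  -- Every set is counted 2^|us| times, so summing a local inequality over all W replaces
  -- conditioning on the part of W outside `us`.
  ∑-assignments : ∀ us (f : Vec Bool n → ℕ) →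
    ∑ (subsets n) (λ W → ∑ (assignments us W) f) ≡ 2 ^ length us * ∑ (subsets n) f
  ∑-assignments [] f = trans (∑-cong (subsets n) λ W → +-identityʳ (f W)) (sym (*-identityˡ _))
  ∑-assignments (u ∷ us) f = begin
    ∑ (subsets n) (λ W → ∑ (assignments (u ∷ us) W) f)
      ≡⟨ ∑-cong (subsets n) (λ W → ∑-++ (assignments us (W [ u ]≔ true)) _ f) ⟩
    ∑ (subsets n) (λ W → g (W [ u ]≔ true) + g (W [ u ]≔ false))
      ≡⟨ ∑-update u g ⟩
    2 * ∑ (subsets n) g
      ≡⟨ cong (2 *_) (∑-assignments us f) ⟩
    2 * (2 ^ length us * ∑ (subsets n) f)
      ≡⟨ *-assoc 2 (2 ^ length us) _ ⟨
    2 * 2 ^ length us * ∑ (subsets n) f ∎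
    where
    open ≡-Reasoning
    g : Vec Bool n → ℕ
    g W = ∑ (assignments us W) f

  AgreeOff : List (Fin n) → Vec Bool n → Vec Bool n → Set
  AgreeOff us W W′ = ∀ i → i ∉ us → lookup W′ i ≡ lookup W i

  private
    AgreeOff-update : ∀ {u us a} {W W′ : Vec Bool n} →
                      AgreeOff us (W [ u ]≔ a) W′ → AgreeOff (u ∷ us) W W′
    AgreeOff-update {u} {us} {a} {W} agree i i∉ =
      trans (agree i (i∉ ∘ there)) (lookup∘update′ (i∉ ∘ here) W a)

  -- Both lists are traversed in parallel, so paired terms receive the same values on `us` and
  -- differ at most at u. Taking g = 0 shows that a count vanishes.
  assignments-mono : ∀ us (u : Fin n) {f g : Vec Bool n → ℕ} W₁ W₂ →
    (∀ i → i ≢ u → lookup W₁ i ≡ lookup W₂ i) →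
    (∀ W₁′ W₂′ → AgreeOff us W₁ W₁′ → AgreeOff us W₂ W₂′ →
      (∀ i → i ≢ u → lookup W₁′ i ≡ lookup W₂′ i) → f W₁′ ≤ g W₂′) →
    ∑ (assignments us W₁) f ≤ ∑ (assignments us W₂) g
  assignments-mono [] u W₁ W₂ eq h =
    +-monoˡ-≤ 0 (h W₁ W₂ (λ _ _ → refl) (λ _ _ → refl) eq)
  assignments-mono (u′ ∷ us) u {f} {g} W₁ W₂ eq h = begin
    ∑ (assignments (u′ ∷ us) W₁) f                          ≡⟨ ∑-++ (assignments us (W₁ [ u′ ]≔ true)) _ f ⟩
    ∑ (assignments us (W₁ [ u′ ]≔ true)) f + _              ≤⟨ +-mono-≤ (rec true) (rec false) ⟩
    ∑ (assignments us (W₂ [ u′ ]≔ true)) g + _              ≡⟨ ∑-++ (assignments us (W₂ [ u′ ]≔ true)) _ g ⟨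
    ∑ (assignments (u′ ∷ us) W₂) g                          ∎
    where
    open ≤-Reasoning
    eq′ : ∀ a i → i ≢ u → lookup (W₁ [ u′ ]≔ a) i ≡ lookup (W₂ [ u′ ]≔ a) i
    eq′ a i i≢u with i Fin.≟ u′
    ... | yes refl = trans (lookup∘update i W₁ a) (sym (lookup∘update i W₂ a))
    ... | no i≢u′ = trans (lookup∘update′ i≢u′ W₁ a)
                      (trans (eq i i≢u) (sym (lookup∘update′ i≢u′ W₂ a)))
    rec : ∀ a → ∑ (assignments us (W₁ [ u′ ]≔ a)) f ≤ ∑ (assignments us (W₂ [ u′ ]≔ a)) g
    rec a = assignments-mono us u (W₁ [ u′ ]≔ a) (W₂ [ u′ ]≔ a) (eq′ a)
      λ W₁′ W₂′ ag₁ ag₂ → h W₁′ W₂′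
        (AgreeOff-update {W = W₁} {W₁′} ag₁)
        (AgreeOff-update {W = W₂} {W₂′} ag₂)

  -- Used to exhibit an independent set that contains v and no neighbour of v.
  assignments-clear : ∀ us W → Unique us → ∃ λ W′ →
    (∀ i → i ∈ us → lookup W′ i ≡ false) × AgreeOff us W W′ ×
    (∀ f → f W′ ≤ ∑ (assignments us W) f)
  assignments-clear [] W [] = W , (λ _ ()) , (λ _ _ → refl) , λ f → m≤m+n (f W) 0
  assignments-clear (u ∷ us) W (u∉us ∷ us!) with assignments-clear us (W [ u ]≔ false) us!
  ... | W′ , cleared , agree , f≤ =
    W′ , cleared′ , AgreeOff-update {W = W} {W′} agree ,
    λ f → ≤-trans (f≤ f) (≤-trans (m≤n+m _ _) (≤-reflexive (sym (∑-++ (assignments us (W [ u ]≔ true)) _ f))))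
    where
    cleared′ : ∀ i → i ∈ (u ∷ us) → lookup W′ i ≡ false
    cleared′ i (there i∈us) = cleared i i∈us
    cleared′ i (here refl) = trans (agree i λ i∈us → All.lookup u∉us i∈us refl) (lookup∘update i W false)

module TriangleFree {n : ℕ} (Adj : Fin n → Fin n → Set) (Adj? : ∀ i j → Dec (Adj i j))
  (Adj-sym : ∀ {i j} → Adj i j → Adj j i) (Adj-irrefl : ∀ {i} → ¬ Adj i i)
  (triangle-free : ∀ {i j k} → Adj i j → Adj i k → ¬ Adj j k) where

  Independent : Vec Bool n → Set
  Independent W = ∀ i j → lookup W i ≡ true → lookup W j ≡ true → ¬ Adj i j

  Independent? : ∀ W → Dec (Independent W)
  Independent? W = Fin.all? λ i → Fin.all? λ j →
    (lookup W i Bool.≟ true) →-dec (lookup W j Bool.≟ true) →-dec ¬? (Adj? i j)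

  ι : Vec Bool n → ℕ
  ι W = 𝟙 (Independent? W)

  neighbours : Fin n → List (Fin n)
  neighbours v = filter (Adj? v) (allFin n)

  degree : Fin n → ℕ
  degree v = ∑ᶠ λ u → 𝟙 (Adj? v u)

  chosen : List (Fin n) → Vec Bool n → ℕ
  chosen us W = ∑ us λ u → ⟦ lookup W u ⟧

  private
    conflict⇒0 : ∀ {W i j} → lookup W i ≡ true → lookup W j ≡ true → Adj i j → ι W ≡ 0
    conflict⇒0 {W} {i} {j} Wi Wj adj = 𝟙-no (Independent? W) λ ind → ind i j Wi Wj adj

  -- Either u is forbidden by W, or choosing it and not choosing it leave the
  -- same number of independent extensions; so the number of extensions is 2ˣ,
  -- for x the number of vertices of us that W allows, and x/2 of them are
  -- chosen on average.  The claim is x 2ˣ ≥ t 2ˣ − 2ᵗ.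
  extensions : ∀ v us W → Unique us → (∀ {u} → u ∈ us → Adj v u) → ∀ t →
    t * ∑ (assignments us W) ι ≤ 2 * ∑ (assignments us W) (λ W′ → ι W′ * chosen us W′) + 2 ^ t
  extensions v [] W _ _ t = ≤-trans (*-monoʳ-≤ t (≤-trans (≤-reflexive (+-identityʳ (ι W))) (⟦⟧≤1 _)))
    (≤-trans (≤-reflexive (*-identityʳ t)) (≤-trans (<⇒≤ (t<2^t t)) (m≤n+m _ _)))
  extensions v (u ∷ us) W (u≢us ∷ us!) N t =
    ≤-trans (≤-reflexive (cong (t *_) (∑-++ (assignments us W₁) _ ι)))
      (≤-trans (split t) (+-monoˡ-≤ (2 ^ t) (*-monoʳ-≤ 2
        (≤-trans (+-mono-≤ Y₁≥ Y₀≥) (≤-reflexive (sym (∑-++ (assignments us W₁) _ _)))))))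
    where
    W₁ = W [ u ]≔ true
    W₀ = W [ u ]≔ false
    Z₁ = ∑ (assignments us W₁) ι
    Z₀ = ∑ (assignments us W₀) ι
    Y : Vec Bool n → ℕ
    Y W′ = ∑ (assignments us W′) λ W″ → ι W″ * chosen us W″
    u∉us : u ∉ us
    u∉us u∈us = All.lookup u≢us u∈us refl

    Y₁≥ : Z₁ + Y W₁ ≤ ∑ (assignments us W₁) (λ W′ → ι W′ * chosen (u ∷ us) W′)
    Y₁≥ = ≤-trans (≤-reflexive (sym (∑-+ (assignments us W₁) ι _)))
      -- Both sides run over the assignments of W₁; what is gained is the knowledge that u keeps the
      -- value `true`.
      (assignments-mono us u W₁ W₁ (λ _ _ → refl) step)
      where
      step : ∀ A B → AgreeOff us W₁ A → AgreeOff us W₁ B →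
             (∀ i → i ≢ u → lookup A i ≡ lookup B i) → ι A + ι A * chosen us A ≤ ι B * chosen (u ∷ us) B
      step A B agA agB eq = ≤-reflexive (trans (sym (*-suc (ι A) _)) (cong₂ _*_ ιeq ceq))
        where
        same : ∀ i → lookup A i ≡ lookup B i
        same i with i Fin.≟ u
        ... | no i≢u = eq i i≢u
        ... | yes refl = trans (agA i u∉us) (sym (agB i u∉us))
        ιeq : ι A ≡ ι B
        ιeq = ≤-antisym
          (𝟙≤ (Independent? A) λ ind → ≤-reflexive (sym (𝟙-yes (Independent? B)
             λ i j Bi Bj → ind i j (trans (same i) Bi) (trans (same j) Bj))))
          (𝟙≤ (Independent? B) λ ind → ≤-reflexive (sym (𝟙-yes (Independent? A)
             λ i j Bi Bj → ind i j (trans (sym (same i)) Bi) (trans (sym (same j)) Bj))))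
        ceq : suc (chosen us A) ≡ chosen (u ∷ us) B
        ceq = cong₂ _+_ (cong ⟦_⟧ (sym (trans (agB u u∉us) (lookup∘update u W true))))
          (∑-cong us λ i → cong ⟦_⟧ (same i))

    Y₀≥ : Y W₀ ≤ ∑ (assignments us W₀) (λ W′ → ι W′ * chosen (u ∷ us) W′)
    Y₀≥ = ∑-mono (assignments us W₀) λ W′ → *-monoʳ-≤ (ι W′) (m≤n+m (chosen us W′) ⟦ lookup W′ u ⟧)

    IH : ∀ t a → t * ∑ (assignments us (W [ u ]≔ a)) ι ≤ 2 * Y (W [ u ]≔ a) + 2 ^ t
    IH t a = extensions v us (W [ u ]≔ a) us! (N ∘ there) t

    split : ∀ t → t * (Z₁ + Z₀) ≤ 2 * (Z₁ + Y W₁ + Y W₀) + 2 ^ t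
    split t with Fin.any? (λ w → (lookup W w Bool.≟ true) ×-dec Adj? u w)
    -- The neighbour w of u is not in `us`, as v, u, w would be a triangle. So w stays in every
    -- extension, and choosing u always conflicts with it.
    ... | yes (w , Ww , uw) = begin
      t * (Z₁ + Z₀)                   ≤⟨ *-monoʳ-≤ t (+-monoˡ-≤ Z₀ Z₁≤0) ⟩
      t * Z₀                          ≤⟨ IH t false ⟩
      2 * Y W₀ + 2 ^ t                ≤⟨ +-monoˡ-≤ (2 ^ t) (*-monoʳ-≤ 2 (m≤n+m (Y W₀) (Z₁ + Y W₁))) ⟩
      2 * (Z₁ + Y W₁ + Y W₀) + 2 ^ t  ∎
      where
      open ≤-Reasoning
      w∉us : w ∉ us
      w∉us w∈us = triangle-free (N (here refl)) (N (there w∈us)) uw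
      Z₁≤0 : Z₁ ≤ 0
      Z₁≤0 = ≤-trans (assignments-mono us u {f = ι} {g = λ _ → 0} W₁ W₁ (λ _ _ → refl)
        λ A _ ag _ _ → ≤-reflexive (conflict⇒0 {A} {u} {w}
          (trans (ag u u∉us) (lookup∘update u W true))
          (trans (ag w w∉us) (trans (lookup∘update′ (λ { refl → Adj-irrefl uw }) W true) Ww)) uw))
        (≤-reflexive (trans (∑-const (assignments us W₁) 0) (*-zeroʳ (length (assignments us W₁)))))
    ... | no free = go t
      where
      open ≤-Reasoning
      blocked : ∀ {A} → AgreeOff us W₁ A → ∀ {i} → lookup A i ≡ true → ¬ Adj u i
      blocked ag {i} Ai ui = free (i ,
        trans (sym (trans (ag i λ i∈us → triangle-free (N (here refl)) (N (there i∈us)) ui)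
                          (lookup∘update′ (λ { refl → Adj-irrefl ui }) W true))) Ai , ui)
      -- No extension contains a neighbour of u, so adding u preserves independence.
      Z₀≤Z₁ : Z₀ ≤ Z₁
      Z₀≤Z₁ = assignments-mono us u W₀ W₁
        (λ i i≢u → trans (lookup∘update′ i≢u W false) (sym (lookup∘update′ i≢u W true)))
        λ A B _ agB eq → 𝟙≤ (Independent? A) λ ind →
          ≤-reflexive (sym (𝟙-yes (Independent? B) (ind′ A B agB eq ind)))
        where
        ind′ : ∀ A B → AgreeOff us W₁ B → (∀ i → i ≢ u → lookup A i ≡ lookup B i) →
               Independent A → Independent B
        ind′ A B agB eq ind i j Bi Bj ij with i Fin.≟ u | j Fin.≟ u
        ... | yes refl | _ = blocked {B} agB Bj ij
        ... | no _ | yes refl = blocked {B} agB Bi (Adj-sym ij)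
        ... | no i≢u | no j≢u = ind i j (trans (eq i i≢u) Bi) (trans (eq j j≢u) Bj) ij
      go : ∀ t → t * (Z₁ + Z₀) ≤ 2 * (Z₁ + Y W₁ + Y W₀) + 2 ^ t
      go zero = z≤n
      -- Z₁ + Z₀ is at most the 2 Z₁ earned by choosing u, and t copies remain for the two halves,
      -- whose errors 2ᵗ add up to 2ᵗ⁺¹.
      go (suc t) = begin
        Z₁ + Z₀ + t * (Z₁ + Z₀)       ≡⟨ cong (Z₁ + Z₀ +_) (*-distribˡ-+ t Z₁ Z₀) ⟩
        Z₁ + Z₀ + (t * Z₁ + t * Z₀)   ≤⟨ +-mono-≤ (+-monoʳ-≤ Z₁ Z₀≤Z₁) (+-mono-≤ (IH t true) (IH t false)) ⟩
        Z₁ + Z₁ + ((2 * Y W₁ + 2 ^ t) + (2 * Y W₀ + 2 ^ t)) ≡⟨ lemma Z₁ (Y W₁) (Y W₀) (2 ^ t) ⟩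
        2 * (Z₁ + Y W₁ + Y W₀) + 2 ^ suc t ∎
        where
        lemma : ∀ z a c d → z + z + ((2 * a + d) + (2 * c + d)) ≡ 2 * (z + a + c) + 2 * d
        lemma = solve-∀

  module _ (D ℓ : ℕ) (large : 4 ^ ℓ + ℓ ≤ D) where

    charge : Fin n → Vec Bool n → ℕ
    charge v W = D * ⟦ lookup W v ⟧ + chosen (neighbours v) W

    private module Local (v : Fin n) (W : Vec Bool n) where
      open ≤-Reasoning
      us = neighbours v
      us! : Unique us
      us! = filter⁺ (Adj? v) (allFin⁺ n)
      N : ∀ {u} → u ∈ us → Adj v u
      N u∈us = proj₂ (∈-filter⁻ (Adj? v) {xs = allFin n} u∈us)
      v∉us : v ∉ us
      v∉us v∈us = Adj-irrefl (N v∈us)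
      W₁ = W [ v ]≔ true
      W₀ = W [ v ]≔ false
      Z₁ = ∑ (assignments us W₁) ι
      Z₀ = ∑ (assignments us W₀) ι
      Y₀ = ∑ (assignments us W₀) λ A → ι A * chosen us A

      charge₁ : D * Z₁ ≤ ∑ (assignments us W₁) (λ A → ι A * charge v A)
      charge₁ = ≤-trans (≤-reflexive (sym (∑-*ˡ (assignments us W₁) D ι)))
        (assignments-mono us v W₁ W₁ (λ _ _ → refl) λ A B agA agB eq → begin
          D * ι A                 ≡⟨ *-comm D (ι A) ⟩
          ι A * D                 ≤⟨ 𝟙*≤ (Independent? A) (λ ind → step A B agA agB eq ind) ⟩
          ι B * charge v B        ∎)
        where
        step : ∀ A B → AgreeOff us W₁ A → AgreeOff us W₁ B →
               (∀ i → i ≢ v → lookup A i ≡ lookup B i) → Independent A → D ≤ ι B * charge v B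
        step A B agA agB eq ind = begin
          D                         ≡⟨ *-identityʳ D ⟨
          D * ⟦ true ⟧              ≡⟨ cong (λ z → D * ⟦ z ⟧) (trans (agB v v∉us) (lookup∘update v W true)) ⟨
          D * ⟦ lookup B v ⟧        ≤⟨ m≤m+n _ (chosen us B) ⟩
          charge v B                ≡⟨ *-identityˡ _ ⟨
          1 * charge v B            ≡⟨ cong (_* charge v B) (𝟙-yes (Independent? B)
                                         λ i j Bi Bj → ind i j (trans (same i) Bi) (trans (same j) Bj)) ⟨
          ι B * charge v B          ∎
          where
          same : ∀ i → lookup A i ≡ lookup B i
          same i with i Fin.≟ v
          ... | no i≢v = eq i i≢v
          ... | yes refl = trans (agA i v∉us) (sym (agB i v∉us))

      charge₀ : Y₀ ≤ ∑ (assignments us W₀) (λ A → ι A * charge v A)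
      charge₀ = ∑-mono (assignments us W₀) λ A → *-monoʳ-≤ (ι A) (m≤n+m (chosen us A) _)

      -- Extensions without v satisfy `extensions` at t = 2ℓ with error 4^ℓ after halving. An
      -- extension containing v pays for this error and for its own share ℓ out of D, which is the
      -- hypothesis `large`.
      avg : ℓ * (Z₁ + Z₀) ≤ D * Z₁ + Y₀
      avg with Fin.any? (λ i → Fin.any? λ j → (lookup W₀ i Bool.≟ true) ×-dec (lookup W₀ j Bool.≟ true)
                          ×-dec ¬? (Adj? v i) ×-dec ¬? (Adj? v j) ×-dec Adj? i j)
      -- A conflict outside v and its neighbours survives every assignment, so no independent
      -- extension omits v.
      ... | yes (i , j , Wi , Wj , ¬vi , ¬vj , ij) = begin
        ℓ * (Z₁ + Z₀)  ≤⟨ *-monoʳ-≤ ℓ (+-monoʳ-≤ Z₁ Z₀≤0) ⟩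
        ℓ * (Z₁ + 0)   ≡⟨ cong (ℓ *_) (+-identityʳ Z₁) ⟩
        ℓ * Z₁         ≤⟨ *-monoˡ-≤ Z₁ (≤-trans (m≤n+m ℓ _) large) ⟩
        D * Z₁         ≤⟨ m≤m+n _ Y₀ ⟩
        D * Z₁ + Y₀    ∎
        where
        Z₀≤0 : Z₀ ≤ 0
        Z₀≤0 = ≤-trans (assignments-mono us v {f = ι} {g = λ _ → 0} W₀ W₀ (λ _ _ → refl)
          λ A _ ag _ _ → ≤-reflexive (conflict⇒0 {A} {i} {j}
            (trans (ag i (¬vi ∘ N)) Wi) (trans (ag j (¬vj ∘ N)) Wj) ij))
          (≤-reflexive (trans (∑-const (assignments us W₀) 0) (*-zeroʳ (length (assignments us W₀)))))
      ... | no consistent = begin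
        ℓ * (Z₁ + Z₀)           ≡⟨ *-distribˡ-+ ℓ Z₁ Z₀ ⟩
        ℓ * Z₁ + ℓ * Z₀         ≤⟨ +-monoʳ-≤ (ℓ * Z₁) (*-cancelˡ-≤ 2 bound) ⟩
        ℓ * Z₁ + (Y₀ + 4 ^ ℓ)   ≤⟨ +-monoʳ-≤ (ℓ * Z₁) (+-monoʳ-≤ Y₀ (m≤m*n (4 ^ ℓ) Z₁ {{>-nonZero Z₁>0}})) ⟩
        ℓ * Z₁ + (Y₀ + 4 ^ ℓ * Z₁) ≡⟨ lemma ℓ Z₁ Y₀ (4 ^ ℓ) ⟩
        (4 ^ ℓ + ℓ) * Z₁ + Y₀   ≤⟨ +-monoˡ-≤ Y₀ (*-monoˡ-≤ Z₁ large) ⟩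
        D * Z₁ + Y₀             ∎
        where
        lemma : ∀ l z a p → l * z + (a + p * z) ≡ (p + l) * z + a
        lemma = solve-∀
        bound : 2 * (ℓ * Z₀) ≤ 2 * (Y₀ + 4 ^ ℓ)
        bound = begin
          2 * (ℓ * Z₀)           ≡⟨ *-assoc 2 ℓ Z₀ ⟨
          2 * ℓ * Z₀             ≤⟨ extensions v us W₀ us! N (2 * ℓ) ⟩
          2 * Y₀ + 2 ^ (2 * ℓ)   ≡⟨ cong (2 * Y₀ +_) (^-*-assoc 2 2 ℓ) ⟨
          2 * Y₀ + 4 ^ ℓ         ≤⟨ +-monoʳ-≤ (2 * Y₀) (m≤m+n (4 ^ ℓ) _) ⟩
          2 * Y₀ + 2 * 4 ^ ℓ     ≡⟨ *-distribˡ-+ 2 Y₀ (4 ^ ℓ) ⟨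
          2 * (Y₀ + 4 ^ ℓ)       ∎
        -- Without such a conflict, adding v and removing all its neighbours gives an independent
        -- set.
        Z₁>0 : 0 < Z₁
        Z₁>0 with assignments-clear us W₁ us!
        ... | A , cleared , agree , ≤∑ = ≤-trans (≤-reflexive (sym (𝟙-yes (Independent? A) ind))) (≤∑ ι)
          where
          outside : ∀ i → lookup A i ≡ true → ¬ Adj v i
          outside i Ai vi = contradiction
            (trans (sym Ai) (cleared i (∈-filter⁺ (Adj? v) (∈-allFin i) vi))) λ ()
          inW₀ : ∀ i → i ≢ v → lookup A i ≡ true → lookup W₀ i ≡ true
          inW₀ i i≢v Ai = trans (lookup∘update′ i≢v W false)
            (trans (sym (trans (agree i (outside i Ai ∘ N)) (lookup∘update′ i≢v W true))) Ai)
          ind : Independent A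
          ind i j Ai Aj ij with i Fin.≟ v | j Fin.≟ v
          ... | yes refl | _ = outside j Aj ij
          ... | no _ | yes refl = outside i Ai (Adj-sym ij)
          ... | no i≢v | no j≢v =
            consistent (i , j , inW₀ i i≢v Ai , inW₀ j j≢v Aj , outside i Ai , outside j Aj , ij)

      local : ∑ (assignments (v ∷ us) W) (λ A → ℓ * ι A) ≤ ∑ (assignments (v ∷ us) W) (λ A → ι A * charge v A)
      local = begin
        ∑ (assignments (v ∷ us) W) (λ A → ℓ * ι A)  ≡⟨ ∑-*ˡ (assignments (v ∷ us) W) ℓ ι ⟩
        ℓ * ∑ (assignments (v ∷ us) W) ι            ≡⟨ cong (ℓ *_) (∑-++ (assignments us W₁) _ ι) ⟩
        ℓ * (Z₁ + Z₀)                               ≤⟨ avg ⟩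
        D * Z₁ + Y₀                                 ≤⟨ +-mono-≤ charge₁ charge₀ ⟩
        ∑ (assignments us W₁) _ + ∑ (assignments us W₀) _  ≡⟨ ∑-++ (assignments us W₁) _ _ ⟨
        ∑ (assignments (v ∷ us) W) (λ A → ι A * charge v A) ∎

    average-charge : ∀ v → ℓ * ∑ (subsets n) ι ≤ ∑ (subsets n) λ W → ι W * charge v W
    average-charge v = *-cancelˡ-≤ (2 ^ length us) {{m^n≢0 2 (length us)}} (begin
      2 ^ length us * (ℓ * ∑ (subsets n) ι)          ≡⟨ cong (2 ^ length us *_) (∑-*ˡ (subsets n) ℓ ι) ⟨
      2 ^ length us * ∑ (subsets n) (λ W → ℓ * ι W)  ≡⟨ ∑-assignments us _ ⟨
      ∑ (subsets n) (λ W → ∑ (assignments us W) (λ A → ℓ * ι A)) ≤⟨ ∑-mono (subsets n) (Local.local v) ⟩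
      ∑ (subsets n) (λ W → ∑ (assignments us W) (λ A → ι A * charge v A)) ≡⟨ ∑-assignments us _ ⟩
      2 ^ length us * ∑ (subsets n) (λ W → ι W * charge v W) ∎)
      where
      open ≤-Reasoning
      us = v ∷ neighbours v

    -- Summed over v, the charge of an independent W is D|W| plus the degrees of its vertices, hence
    -- at most (D + h)|W|, while each v contributes at least ℓ on average over W.
    independence-bound : ∀ h → (∀ v → degree v ≤ h) → (∀ W → Independent W → size W ≤ h) →
                         n * ℓ ≤ (D + h) * h
    independence-bound h deg≤ ind≤ = *-cancelʳ-≤ (n * ℓ) ((D + h) * h) I {{>-nonZero I>0}} (begin
      n * ℓ * I                                              ≡⟨ *-assoc n ℓ I ⟩
      n * (ℓ * I)                                            ≡⟨ ∑ᶠ-const {n} (ℓ * I) ⟨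
      ∑ᶠ {n} (λ _ → ℓ * I)                                   ≤⟨ ∑-mono (allFin n) average-charge ⟩
      ∑ᶠ (λ v → ∑ (subsets n) λ W → ι W * charge v W)        ≡⟨ ∑-swap (allFin n) (subsets n) _ ⟩
      ∑ (subsets n) (λ W → ∑ᶠ λ v → ι W * charge v W)        ≤⟨ ∑-mono (subsets n) total ⟩
      ∑ (subsets n) (λ W → (D + h) * h * ι W)                ≡⟨ ∑-*ˡ (subsets n) ((D + h) * h) ι ⟩
      (D + h) * h * I ∎)
      where
      open ≤-Reasoning
      I = ∑ (subsets n) ι
      total : ∀ W → ∑ᶠ (λ v → ι W * charge v W) ≤ (D + h) * h * ι W
      total W = begin
        ∑ᶠ (λ v → ι W * charge v W)  ≡⟨ ∑-*ˡ (allFin n) (ι W) _ ⟩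
        ι W * ∑ᶠ (λ v → charge v W)  ≤⟨ 𝟙*≤ (Independent? W) (λ ind → sum≤ ind) ⟩
        (D + h) * h * ι W            ∎
        where
        charges : ∑ᶠ (λ v → charge v W) ≤ (D + h) * size W
        charges = begin
          ∑ᶠ (λ v → charge v W)  ≡⟨ ∑-+ (allFin n) _ _ ⟩
          ∑ᶠ (λ v → D * ⟦ lookup W v ⟧) + ∑ᶠ (λ v → chosen (neighbours v) W)
            ≡⟨ cong₂ _+_ (∑-*ˡ (allFin n) D _)
                 (trans (∑-cong (allFin n) λ v → ∑-filter (Adj? v) (allFin n) _) (∑-swap (allFin n) (allFin n) _)) ⟩
          D * size W + ∑ᶠ (λ u → ∑ᶠ λ v → 𝟙 (Adj? v u) * ⟦ lookup W u ⟧)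
            ≤⟨ +-monoʳ-≤ (D * size W) (∑-mono (allFin n) λ u → begin
                 ∑ᶠ (λ v → 𝟙 (Adj? v u) * ⟦ lookup W u ⟧) ≡⟨ ∑-*ʳ (allFin n) _ _ ⟩
                 ∑ᶠ (λ v → 𝟙 (Adj? v u)) * ⟦ lookup W u ⟧ ≤⟨ *-monoˡ-≤ ⟦ lookup W u ⟧ (≤-trans
                   (∑-mono (allFin n) λ v → 𝟙≤ (Adj? v u) λ a → ≤-reflexive (sym (𝟙-yes (Adj? u v) (Adj-sym a))))
                   (deg≤ u)) ⟩
                 h * ⟦ lookup W u ⟧ ∎) ⟩
          D * size W + ∑ᶠ (λ u → h * ⟦ lookup W u ⟧)  ≡⟨ cong (D * size W +_) (∑-*ˡ (allFin n) h _) ⟩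
          D * size W + h * size W  ≡⟨ *-distribʳ-+ (size W) D h ⟨
          (D + h) * size W  ∎
        sum≤ : Independent W → ∑ᶠ (λ v → charge v W) ≤ (D + h) * h * ι W
        sum≤ ind = begin
          ∑ᶠ (λ v → charge v W)  ≤⟨ charges ⟩
          (D + h) * size W       ≤⟨ *-monoʳ-≤ (D + h) (ind≤ W ind) ⟩
          (D + h) * h            ≡⟨ *-identityʳ _ ⟨
          (D + h) * h * 1        ≡⟨ cong ((D + h) * h *_) (𝟙-yes (Independent? W) ind) ⟨
          (D + h) * h * ι W      ∎
      I>0 : 0 < I
      I>0 = ≤-trans (≤-reflexive (sym (𝟙-yes (Independent? ∅) λ i j Wi → contradiction Wi
               (λ eq → contradiction (trans (sym (lookup-replicate i false)) eq) λ ()))))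
             (≤∑-subsets ι ∅)
        where
        ∅ = Vec.replicate n false

-- Random bit matrices

-- As m = 2h is even, the power splits into two halves, and Bernoulli's inequality bounds each by 2.
[1+1/m]^m≤4 : ∀ h → suc (2 * h) ^ (2 * h) ≤ 4 * (2 * h) ^ (2 * h)
[1+1/m]^m≤4 h = begin
  suc m ^ m             ≡⟨ cong (suc m ^_) (*-comm 2 h) ⟩
  suc m ^ (h * 2)       ≡⟨ ^-*-assoc (suc m) h 2 ⟨
  (suc m ^ h) ^ 2       ≤⟨ ^-monoˡ-≤ 2 half ⟩
  (2 * m ^ h) ^ 2       ≡⟨ lemma (m ^ h) ⟩
  4 * (m ^ h) ^ 2       ≡⟨ cong (4 *_) (trans (^-*-assoc m h 2) (cong (m ^_) (*-comm h 2))) ⟩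
  4 * m ^ m             ∎
  where
  open ≤-Reasoning
  m = 2 * h
  lemma : ∀ a → (2 * a) * ((2 * a) * 1) ≡ 4 * (a * (a * 1))
  lemma = solve-∀
  -- This is 1 - s/(m+1) ≤ (1 - 1/(m+1))^s with t = m + 1 - s, cleared of denominators.
  bernoulli : ∀ s t → s + t ≡ suc m → suc m ^ s * t ≤ suc m * m ^ s
  bernoulli zero t refl = ≤-reflexive (lemma₀ (suc m))
    where
    lemma₀ : ∀ a → 1 * a ≡ a * 1
    lemma₀ = solve-∀
  bernoulli (suc s) t eq = begin
    suc m ^ suc s * t        ≡⟨ lemma₁ (suc m) (suc m ^ s) t ⟩
    suc m ^ s * (suc m * t)  ≤⟨ *-monoʳ-≤ (suc m ^ s) step ⟩
    suc m ^ s * (suc t * m)  ≡⟨ lemma₂ (suc m ^ s) (suc t) m ⟩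
    m * (suc m ^ s * suc t)  ≤⟨ *-monoʳ-≤ m (bernoulli s (suc t) (trans (+-suc s t) eq)) ⟩
    m * (suc m * m ^ s)      ≡⟨ lemma₃ m (suc m) (m ^ s) ⟩
    suc m * m ^ suc s        ∎
    where
    lemma₁ : ∀ a c t → a * c * t ≡ c * (a * t)
    lemma₁ = solve-∀
    lemma₂ : ∀ a c t → a * (c * t) ≡ t * (a * c)
    lemma₂ = solve-∀
    lemma₃ : ∀ a c t → a * (c * t) ≡ c * (a * t)
    lemma₃ = solve-∀
    step : suc m * t ≤ suc t * m
    step = ≤-trans (+-monoˡ-≤ (m * t) (≤-trans (m≤n+m t s) (≤-reflexive (suc-injective eq))))
      (≤-reflexive (cong (m +_) (*-comm m t)))
  half : suc m ^ h ≤ 2 * m ^ h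
  half = *-cancelˡ-≤ (suc m) (begin
    suc m * suc m ^ h          ≤⟨ *-monoˡ-≤ (suc m ^ h) (≤-trans (n≤1+n (suc m)) (≤-reflexive (lemma₀ h))) ⟩
    2 * suc h * suc m ^ h      ≡⟨ lemma₁ (suc h) (suc m ^ h) ⟩
    2 * (suc m ^ h * suc h)    ≤⟨ *-monoʳ-≤ 2 (bernoulli h (suc h) (lemma₂ h)) ⟩
    2 * (suc m * m ^ h)        ≡⟨ lemma₃ (suc m) (m ^ h) ⟩
    suc m * (2 * m ^ h)        ∎)
    where
    lemma₀ : ∀ h → 2 + 2 * h ≡ 2 * (1 + h)
    lemma₀ = solve-∀
    lemma₁ : ∀ a c → 2 * a * c ≡ 2 * (c * a)
    lemma₁ = solve-∀
    lemma₂ : ∀ h → h + (1 + h) ≡ 1 + 2 * h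
    lemma₂ = solve-∀
    lemma₃ : ∀ a c → 2 * (a * c) ≡ a * (2 * c)
    lemma₃ = solve-∀

-- Bernoulli's inequality 1 + s/q ≤ (1 + 1/q)^s at s = q gives (1 + 1/q)^q ≥ 2, hence (1 - 1/m)^m ≤
-- 1/2 for m = q + 1.
2[m-1]^m≤m^m : ∀ q .{{_ : NonZero q}} → 2 * q ^ suc q ≤ suc q ^ suc q
2[m-1]^m≤m^m q = begin
  2 * (q * q ^ q)              ≡⟨ lemma₁ q (q ^ q) ⟩
  (q + q) * q ^ q              ≤⟨ bernoulli q ⟩
  q * suc q ^ q                ≤⟨ *-monoˡ-≤ (suc q ^ q) (n≤1+n q) ⟩
  suc q ^ suc q                ∎
  where
  open ≤-Reasoning
  lemma₁ : ∀ a c → 2 * (a * c) ≡ (a + a) * c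
  lemma₁ = solve-∀
  bernoulli : ∀ s → (q + s) * q ^ s ≤ q * suc q ^ s
  bernoulli zero = ≤-reflexive (cong (_* 1) (+-identityʳ q))
  bernoulli (suc s) = begin
    (q + suc s) * (q * q ^ s)      ≡⟨ lemma₂ q s (q ^ s) ⟩
    (q * q + q * s + q) * q ^ s    ≤⟨ *-monoˡ-≤ (q ^ s) (m≤m+n (q * q + q * s + q) s) ⟩
    (q * q + q * s + q + s) * q ^ s ≡⟨ lemma₃ q s (q ^ s) ⟩
    suc q * ((q + s) * q ^ s)      ≤⟨ *-monoʳ-≤ (suc q) (bernoulli s) ⟩
    suc q * (q * suc q ^ s)        ≡⟨ lemma₄ (suc q) q (suc q ^ s) ⟩
    q * suc q ^ suc s              ∎
    where
    lemma₂ : ∀ q s c → (q + (1 + s)) * (q * c) ≡ (q * q + q * s + q) * c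
    lemma₂ = solve-∀
    lemma₃ : ∀ q s c → (q * q + q * s + q + s) * c ≡ (1 + q) * ((q + s) * c)
    lemma₃ = solve-∀
    lemma₄ : ∀ a c t → a * (c * t) ≡ c * (a * t)
    lemma₄ = solve-∀

^-distribʳ-* : ∀ e a c → (a * c) ^ e ≡ a ^ e * c ^ e
^-distribʳ-* zero a c = refl
^-distribʳ-* (suc e) a c rewrite ^-distribʳ-* e a c = lemma a c (a ^ e) (c ^ e)
  where
  lemma : ∀ a c d e → a * c * (d * e) ≡ a * d * (c * e)
  lemma = solve-∀

^-scale : ∀ {a c k m} → a ^ m ≤ k * c ^ m → ∀ E → a ^ (m * E) ≤ k ^ E * c ^ (m * E)
^-scale {a} {c} {k} {m} h E = begin
  a ^ (m * E)            ≡⟨ ^-*-assoc a m E ⟨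
  (a ^ m) ^ E            ≤⟨ ^-monoˡ-≤ E h ⟩
  (k * c ^ m) ^ E        ≡⟨ ^-distribʳ-* E k (c ^ m) ⟩
  k ^ E * (c ^ m) ^ E    ≡⟨ cong (k ^ E *_) (^-*-assoc c m E) ⟩
  k ^ E * c ^ (m * E)    ∎
  where open ≤-Reasoning

Matrix : ℕ → Set
Matrix n = Vec (Vec Bool n) n

entry : ∀ {n} → Matrix n → Fin n → Fin n → Bool
entry x i j = lookup (lookup x i) j

∑∑ : ∀ {n} → (Fin n → Fin n → ℕ) → ℕ
∑∑ f = ∑ᶠ λ i → ∑ᶠ (f i)

∏∏ : ∀ {n} → (Fin n → Fin n → ℕ) → ℕ
∏∏ f = ∏ λ i → ∏ (f i)

∏∏-cong : ∀ {n} {f g : Fin n → Fin n → ℕ} → (∀ i j → f i j ≡ g i j) → ∏∏ f ≡ ∏∏ g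
∏∏-cong h = ∏-cong λ i → ∏-cong (h i)

∏∏-* : ∀ {n} (f g : Fin n → Fin n → ℕ) → ∏∏ (λ i j → f i j * g i j) ≡ ∏∏ f * ∏∏ g
∏∏-* f g = trans (∏-cong λ i → ∏-* (f i) (g i)) (∏-* (∏ ∘ f) (∏ ∘ g))

∏∏-^ : ∀ {n} c (f : Fin n → Fin n → ℕ) → ∏∏ (λ i j → c ^ f i j) ≡ c ^ ∑∑ f
∏∏-^ c f = trans (∏-cong λ i → ∏-^ c (f i)) (∏-^ c (∑ᶠ ∘ f))

∏∏-const : ∀ n c → ∏∏ {n} (λ _ _ → c) ≡ (c ^ n) ^ n
∏∏-const n c = trans (∏-cong {n} λ _ → ∏-const n c) (∏-const n (c ^ n))

RowCausal : ∀ {n} {A : Set} → (Matrix n → Fin n → Fin n → A) → Set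
RowCausal τ = ∀ x x′ i → (∀ j → j Fin.< i → lookup x j ≡ lookup x′ j) → ∀ j → τ x i j ≡ τ x′ i j

hits : ∀ {n} → (Fin n → Fin n → Bool) → Matrix n → ℕ
hits c x = ∑∑ λ i j → ⟦ c i j ∧ entry x i j ⟧

-- A list stands for the uniform distribution on its entries, counted with
-- multiplicity; a bit is 1 with probability 1/m.
module Random (q : ℕ) (n : ℕ) where

  m : ℕ
  m = suc q

  bits : List Bool
  bits = true ∷ replicate q false

  ∑-bits : ∀ f → ∑ bits f ≡ f true + q * f false
  ∑-bits f = cong (f true +_) (∑-replicate q false f)

  matrices : List (Matrix n)
  matrices = vectors (vectors bits n) n

  total : ℕ
  total = length matrices

  total≡ : total ≡ (m ^ n) ^ n
  total≡ = trans (length-vectors (vectors bits n) n)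
    (cong (_^ n) (trans (length-vectors bits n) (cong (λ l → suc l ^ n) (length-replicate q))))

  -- `∑-causal-∏` is applied twice: to the rows, where a factor may depend on earlier rows, and
  -- inside a row, where the cells are independent.
  ∑-cells : (g : Matrix n → Fin n → Fin n → Bool → ℕ) (B : Fin n → Fin n → ℕ) →
            (∀ t → RowCausal λ x i j → g x i j t) → (∀ x i j → ∑ bits (g x i j) ≤ B i j) →
            ∑ matrices (λ x → ∏∏ λ i j → g x i j (entry x i j)) ≤ ∏∏ B
  ∑-cells g B causal bound =
    ∑-causal-∏ (Vec.replicate n false) (vectors bits n) (λ x i row → ∏ λ j → g x i j (lookup row j)) _
      (λ x x′ i eq row → ∏-cong λ j → causal (lookup row j) x x′ i eq j)
      λ x i → ∑-causal-∏ false bits (λ _ → g x i) (B i) (λ _ _ _ _ _ → refl) λ _ → bound x i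

  -- The mean of f is at most 2^-β; for an indicator this is a probability.
  Rare : ℕ → (Matrix n → ℕ) → Set
  Rare β f = 2 ^ β * ∑ matrices f ≤ total

  -- The weights let a sum over all subsets count only those of size k.
  union-bound : ∀ {I : Set} (is : List I) (ω : I → ℕ) (f : I → Matrix n → ℕ) l β →
                ∑ is ω ≤ 2 ^ l → (∀ i → 2 ^ (l + β) * ∑ matrices (f i) ≤ ω i * total) →
                Rare β (λ x → ∑ is λ i → f i x)
  union-bound is ω f l β ω≤ rare = *-cancelˡ-≤ (2 ^ l) {{m^n≢0 2 l}} (begin
    2 ^ l * (2 ^ β * ∑ matrices (λ x → ∑ is λ i → f i x))   ≡⟨ *-assoc (2 ^ l) (2 ^ β) _ ⟨
    2 ^ l * 2 ^ β * ∑ matrices (λ x → ∑ is λ i → f i x)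
      ≡⟨ cong₂ _*_ (sym (^-distribˡ-+-* 2 l β)) (∑-swap matrices is _) ⟩
    2 ^ (l + β) * ∑ is (λ i → ∑ matrices (f i))             ≡⟨ ∑-*ˡ is (2 ^ (l + β)) _ ⟨
    ∑ is (λ i → 2 ^ (l + β) * ∑ matrices (f i))             ≤⟨ ∑-mono is rare ⟩
    ∑ is (λ i → ω i * total)                                ≡⟨ ∑-*ʳ is total ω ⟩
    ∑ is ω * total                                          ≤⟨ *-monoˡ-≤ total ω≤ ⟩
    2 ^ l * total                                           ∎)
    where open ≤-Reasoning

  -- Markov's inequality for 2^hits, scaled by m^C.
  tail : ∀ c a → let C = ∑∑ (λ i j → ⟦ c i j ⟧) in
         ∑ matrices (λ x → 𝟙 (a ≤? hits c x)) * (2 ^ a * m ^ C) ≤ total * suc m ^ C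
  tail c a = begin
    ∑ matrices (λ x → 𝟙 (a ≤? hits c x)) * (2 ^ a * m ^ C)    ≡⟨ ∑-*ʳ matrices _ _ ⟨
    ∑ matrices (λ x → 𝟙 (a ≤? hits c x) * (2 ^ a * m ^ C))
      ≤⟨ ∑-mono matrices (λ x → 𝟙*≤ (a ≤? hits c x) (markov x)) ⟩
    ∑ matrices (λ x → ∏∏ λ i j → g (c i j) (entry x i j))
      ≤⟨ ∑-cells (λ _ i j → g (c i j)) (λ i j → B (c i j)) (λ _ _ _ _ _ _ → refl) (λ _ i j → bound (c i j)) ⟩
    ∏∏ (λ i j → m * suc m ^ ⟦ c i j ⟧)                        ≡⟨ ∏∏-* (λ _ _ → m) (λ i j → suc m ^ ⟦ c i j ⟧) ⟩
    ∏∏ {n} (λ _ _ → m) * ∏∏ (λ i j → suc m ^ ⟦ c i j ⟧)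
      ≡⟨ cong₂ _*_ (trans (∏∏-const n m) (sym total≡)) (∏∏-^ (suc m) (λ i j → ⟦ c i j ⟧)) ⟩
    total * suc m ^ C                                         ∎
    where
    open ≤-Reasoning
    C = ∑∑ (λ i j → ⟦ c i j ⟧)
    g : Bool → Bool → ℕ
    g t z = 2 ^ ⟦ t ∧ z ⟧ * m ^ ⟦ t ⟧
    B : Bool → ℕ
    B t = m * suc m ^ ⟦ t ⟧
    bound : ∀ t → ∑ bits (g t) ≤ B t
    -- The mean of 2^bit is (2 + q)/m = 1 + 1/m.
    bound true = ≤-reflexive (trans (∑-bits (g true)) (lemma q))
      where
      lemma : ∀ q → 2 * 1 * ((1 + q) * 1) + q * (1 * ((1 + q) * 1)) ≡ (1 + q) * ((2 + q) * 1)
      lemma = solve-∀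
    bound false = ≤-reflexive (trans (∑-bits (g false)) (lemma q))
      where
      lemma : ∀ q → 1 * 1 + q * (1 * 1) ≡ (1 + q) * 1
      lemma = solve-∀
    markov : ∀ x → a ≤ hits c x → 2 ^ a * m ^ C ≤ ∏∏ λ i j → g (c i j) (entry x i j)
    markov x a≤ = begin
      2 ^ a * m ^ C                                 ≤⟨ *-monoˡ-≤ (m ^ C) (^-monoʳ-≤ 2 a≤) ⟩
      2 ^ hits c x * m ^ C
        ≡⟨ cong₂ _*_ (∏∏-^ 2 (λ i j → ⟦ c i j ∧ entry x i j ⟧)) (∏∏-^ m (λ i j → ⟦ c i j ⟧)) ⟨
      ∏∏ (λ i j → 2 ^ ⟦ c i j ∧ entry x i j ⟧) * ∏∏ (λ i j → m ^ ⟦ c i j ⟧)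
        ≡⟨ ∏∏-* (λ i j → 2 ^ ⟦ c i j ∧ entry x i j ⟧) (λ i j → m ^ ⟦ c i j ⟧) ⟨
      ∏∏ (λ i j → g (c i j) (entry x i j))          ∎

  module _ (m≤4 : suc m ^ m ≤ 4 * m ^ m) where

    -- The mean of 2^hits is at most (1 + 1/m)^C ≤ 4^E, so Markov's inequality at 2^(2E + β) leaves
    -- exactly 2^-β.
    tail-rare : ∀ c E β → ∑∑ (λ i j → ⟦ c i j ⟧) ≤ m * E → Rare β (λ x → 𝟙 (2 * E + β ≤? hits c x))
    tail-rare c E β C≤ = *-cancelʳ-≤ _ _ (4 ^ E * m ^ C) {{m*n≢0 _ _ {{m^n≢0 4 E}} {{m^n≢0 m C}}}} (begin
      2 ^ β * S * (4 ^ E * m ^ C)           ≡⟨ lemma (2 ^ β) S (4 ^ E) (m ^ C) ⟩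
      S * (4 ^ E * 2 ^ β * m ^ C)
        ≡⟨ cong (λ z → S * (z * m ^ C)) (trans (cong (_* 2 ^ β) (^-*-assoc 2 2 E)) (sym (^-distribˡ-+-* 2 (2 * E) β))) ⟩
      S * (2 ^ (2 * E + β) * m ^ C)         ≤⟨ tail c (2 * E + β) ⟩
      total * suc m ^ C                     ≤⟨ *-monoʳ-≤ total ratio ⟩
      total * (4 ^ E * m ^ C)               ∎)
      where
      open ≤-Reasoning
      C = ∑∑ (λ i j → ⟦ c i j ⟧)
      S = ∑ matrices (λ x → 𝟙 (2 * E + β ≤? hits c x))
      -- Pads the exponent C to the multiple m E of m, where `m≤4` applies.
      e = m * E ∸ C
      lemma : ∀ a s c d → a * s * (c * d) ≡ s * (c * a * d)
      lemma = solve-∀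
      ratio : suc m ^ C ≤ 4 ^ E * m ^ C
      ratio = *-cancelʳ-≤ _ _ (m ^ e) {{m^n≢0 m e}} (begin
        suc m ^ C * m ^ e         ≤⟨ *-monoʳ-≤ (suc m ^ C) (^-monoˡ-≤ e (n≤1+n m)) ⟩
        suc m ^ C * suc m ^ e     ≡⟨ ^-distribˡ-+-* (suc m) C e ⟨
        suc m ^ (C + e)           ≡⟨ cong (suc m ^_) (m+[n∸m]≡n C≤) ⟩
        suc m ^ (m * E)           ≤⟨ ^-scale {c = m} {m = m} m≤4 E ⟩
        4 ^ E * m ^ (m * E)       ≡⟨ cong (λ z → 4 ^ E * m ^ z) (m+[n∸m]≡n C≤) ⟨
        4 ^ E * m ^ (C + e)       ≡⟨ cong (4 ^ E *_) (^-distribˡ-+-* m C e) ⟩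
        4 ^ E * (m ^ C * m ^ e)   ≡⟨ *-assoc (4 ^ E) _ _ ⟨
        4 ^ E * m ^ C * m ^ e     ∎)

  module _ .{{_ : NonZero q}} (τ : Matrix n → Fin n → Fin n → Bool) (causal : RowCausal τ) where

    tests : Matrix n → ℕ
    tests x = ∑∑ λ i j → ⟦ τ x i j ⟧

    Missed : Matrix n → Set
    Missed x = ∀ i j → τ x i j ≡ true → entry x i j ≡ false

    Missed? : ∀ x → Dec (Missed x)
    Missed? x = Fin.all? λ i → Fin.all? λ j → (τ x i j Bool.≟ true) →-dec (entry x i j Bool.≟ false)

    -- Each test fails with probability q/m given the earlier rows.  The weight
    -- of a cell, m or 0 if tested and q if not, has the same mean either way.
    missed-tail : ∀ M → ∑ matrices (λ x → 𝟙 (Missed? x ×-dec (M ≤? tests x))) * m ^ M ≤ q ^ M * total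
    missed-tail M = *-cancelʳ-≤ _ _ Q {{subst NonZero (sym (∏∏-const n q)) (m^n≢0 (q ^ n) n {{m^n≢0 q n}})}} (begin
      S * m ^ M * Q           ≡⟨ *-assoc S _ Q ⟩
      S * (m ^ M * Q)         ≡⟨ ∑-*ʳ matrices _ _ ⟨
      ∑ matrices (λ x → 𝟙 (Missed? x ×-dec (M ≤? tests x)) * (m ^ M * Q))
        ≤⟨ ∑-mono matrices (λ x → 𝟙*≤ (Missed? x ×-dec (M ≤? tests x)) λ (miss , M≤) → weight≥ x miss M≤) ⟩
      ∑ matrices (λ x → q ^ M * weight x)   ≡⟨ ∑-*ˡ matrices (q ^ M) weight ⟩
      q ^ M * ∑ matrices weight
        ≤⟨ *-monoʳ-≤ (q ^ M) (∑-cells (λ x i j → cell (τ x i j)) (λ _ _ → m * q)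
          (λ z x x′ i eq j → cong (λ t → cell t z) (causal x x′ i eq j)) (λ x i j → bound (τ x i j))) ⟩
      q ^ M * ∏∏ {n} (λ _ _ → m * q)        ≡⟨ cong (q ^ M *_) (∏∏-* {n} (λ _ _ → m) (λ _ _ → q)) ⟩
      q ^ M * (∏∏ {n} (λ _ _ → m) * Q)
        ≡⟨ cong (λ z → q ^ M * (z * Q)) (trans (∏∏-const n m) (sym total≡)) ⟩
      q ^ M * (total * Q)                   ≡⟨ *-assoc (q ^ M) total Q ⟨
      q ^ M * total * Q                     ∎)
      where
      open ≤-Reasoning
      Q = ∏∏ {n} (λ _ _ → q)
      S = ∑ matrices (λ x → 𝟙 (Missed? x ×-dec (M ≤? tests x)))
      cell : Bool → Bool → ℕ
      cell true true = 0
      cell true false = m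
      cell false _ = q
      bound : ∀ t → ∑ bits (cell t) ≤ m * q
      bound true = ≤-reflexive (trans (∑-bits (cell true)) (*-comm q m))
      bound false = ≤-reflexive (∑-bits (cell false))
      weight : Matrix n → ℕ
      weight x = ∏∏ λ i j → cell (τ x i j) (entry x i j)
      -- If all t tests miss, the weight is (m/q)^t Q, which is at least (m/q)^M Q because t ≥ M.
      weight≥ : ∀ x → Missed x → M ≤ tests x → m ^ M * Q ≤ q ^ M * weight x
      weight≥ x miss M≤ = begin
        m ^ M * Q                                      ≡⟨ cong (m ^ M *_) (∏∏-cong λ i j → q≡ (τ x i j)) ⟩
        m ^ M * ∏∏ (λ i j → q ^ ⟦ τ x i j ⟧ * co i j)
          ≡⟨ cong (m ^ M *_) (trans (∏∏-* (λ i j → q ^ ⟦ τ x i j ⟧) co) (cong (_* R) (∏∏-^ q (λ i j → ⟦ τ x i j ⟧)))) ⟩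
        m ^ M * (q ^ t * R)                            ≡⟨ cong (λ z → m ^ M * (q ^ z * R)) (m+[n∸m]≡n M≤) ⟨
        m ^ M * (q ^ (M + e) * R)                      ≡⟨ cong (λ z → m ^ M * (z * R)) (^-distribˡ-+-* q M e) ⟩
        m ^ M * (q ^ M * q ^ e * R)
          ≤⟨ *-monoʳ-≤ (m ^ M) (*-monoˡ-≤ R (*-monoʳ-≤ (q ^ M) (^-monoˡ-≤ e (n≤1+n q)))) ⟩
        m ^ M * (q ^ M * m ^ e * R)                    ≡⟨ lemma (m ^ M) (q ^ M) (m ^ e) R ⟩
        q ^ M * (m ^ M * m ^ e * R)
          ≡⟨ cong (λ z → q ^ M * (z * R)) (trans (sym (^-distribˡ-+-* m M e)) (cong (m ^_) (m+[n∸m]≡n M≤))) ⟩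
        q ^ M * (m ^ t * R)
          ≡⟨ cong (λ z → q ^ M * (z * R)) (∏∏-^ m (λ i j → ⟦ τ x i j ⟧)) ⟨
        q ^ M * (∏∏ (λ i j → m ^ ⟦ τ x i j ⟧) * R)
          ≡⟨ cong (q ^ M *_) (trans (sym (∏∏-* (λ i j → m ^ ⟦ τ x i j ⟧) co)) (∏∏-cong λ i j → sym (cell≡ (τ x i j) (entry x i j) (miss i j)))) ⟩
        q ^ M * weight x                               ∎
        where
        t = tests x
        e = t ∸ M
        co : Fin n → Fin n → ℕ
        co i j = q ^ ⟦ not (τ x i j) ⟧
        R = ∏∏ co
        lemma : ∀ a c d f → a * (c * d * f) ≡ c * (a * d * f)
        lemma = solve-∀
        q≡ : ∀ t → q ≡ q ^ ⟦ t ⟧ * q ^ ⟦ not t ⟧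
        q≡ true = lemma′ q
          where
          lemma′ : ∀ q → q ≡ q * 1 * 1
          lemma′ = solve-∀
        q≡ false = lemma′ q
          where
          lemma′ : ∀ q → q ≡ 1 * (q * 1)
          lemma′ = solve-∀
        cell≡ : ∀ t z → (t ≡ true → z ≡ false) → cell t z ≡ m ^ ⟦ t ⟧ * q ^ ⟦ not t ⟧
        cell≡ true true h = contradiction (h refl) λ ()
        cell≡ true false h = lemma′ m
          where
          lemma′ : ∀ m → m ≡ m * 1 * 1
          lemma′ = solve-∀
        cell≡ false _ h = q≡ false

    -- The probability of missing m E tests is at most (1 - 1/m)^(m E) ≤ 2^-E.
    missed-rare : ∀ E → Rare E (λ x → 𝟙 (Missed? x ×-dec (m * E ≤? tests x)))
    missed-rare E = *-cancelʳ-≤ _ _ (m ^ (m * E)) {{m^n≢0 m (m * E)}} (begin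
      2 ^ E * S * m ^ (m * E)       ≡⟨ *-assoc (2 ^ E) S _ ⟩
      2 ^ E * (S * m ^ (m * E))     ≤⟨ *-monoʳ-≤ (2 ^ E) (missed-tail (m * E)) ⟩
      2 ^ E * (q ^ (m * E) * total) ≡⟨ *-assoc (2 ^ E) _ total ⟨
      2 ^ E * q ^ (m * E) * total   ≤⟨ *-monoˡ-≤ total half ⟩
      m ^ (m * E) * total           ≡⟨ *-comm _ total ⟩
      total * m ^ (m * E)           ∎)
      where
      open ≤-Reasoning
      S = ∑ matrices (λ x → 𝟙 (Missed? x ×-dec (m * E ≤? tests x)))
      half : 2 ^ E * q ^ (m * E) ≤ m ^ (m * E)
      half = begin
        2 ^ E * q ^ (m * E)     ≡⟨ cong (2 ^ E *_) (^-*-assoc q m E) ⟨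
        2 ^ E * (q ^ m) ^ E     ≡⟨ ^-distribʳ-* E 2 (q ^ m) ⟨
        (2 * q ^ m) ^ E         ≤⟨ ^-monoˡ-≤ E (2[m-1]^m≤m^m q) ⟩
        (m ^ m) ^ E             ≡⟨ ^-*-assoc m m E ⟩
        m ^ (m * E)             ∎

-- The graph of a bit matrix

∑ᶠ-* : ∀ {n} (f g : Fin n → ℕ) → ∑ᶠ f * ∑ᶠ g ≡ ∑∑ λ i j → f i * g j
∑ᶠ-* f g = trans (sym (∑-*ʳ (allFin _) (∑ᶠ g) f)) (∑-cong (allFin _) λ i → sym (∑-*ˡ (allFin _) (f i) g))

∑ᶠ-δ : ∀ {n} (i : Fin n) → ∑ᶠ (λ j → 𝟙 (i Fin.≟ j)) ≡ 1
∑ᶠ-δ {suc n} zero = trans (∑ᶠ-suc {n} (λ j → 𝟙 (zero Fin.≟ j))) (cong suc (trans (∑ᶠ-const {n} 0) (*-zeroʳ n)))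
∑ᶠ-δ {suc n} (suc i) = trans (∑ᶠ-suc {n} (λ j → 𝟙 (suc i Fin.≟ j))) (∑ᶠ-δ i)

∑∑-mono : ∀ {n} {f g : Fin n → Fin n → ℕ} → (∀ i j → f i j ≤ g i j) → ∑∑ f ≤ ∑∑ g
∑∑-mono h = ∑-mono (allFin _) λ i → ∑-mono (allFin _) (h i)

∑∑-+ : ∀ {n} (f g : Fin n → Fin n → ℕ) → ∑∑ (λ i j → f i j + g i j) ≡ ∑∑ f + ∑∑ g
∑∑-+ f g = trans (∑-cong (allFin _) λ i → ∑-+ (allFin _) (f i) (g i)) (∑-+ (allFin _) (∑ᶠ ∘ f) (∑ᶠ ∘ g))

does⇒ : ∀ {P : Set} (P? : Dec P) → does P? ≡ true → P
does⇒ (yes p) _ = p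

infix 4 _⊑_

_⊑_ : ∀ {n} → Vec Bool n → Vec Bool n → Set
P ⊑ Q = ∀ i → lookup P i ≡ true → lookup Q i ≡ true

size-∷ : ∀ {n} a (P : Vec Bool n) → size (a ∷ P) ≡ ⟦ a ⟧ + size P
size-∷ a P = ∑ᶠ-suc λ i → ⟦ lookup (a ∷ P) i ⟧

size-mono : ∀ {n} {P Q : Vec Bool n} → P ⊑ Q → size P ≤ size Q
size-mono {P = P} {Q} P⊑Q = ∑-mono (allFin _) λ i → mono (lookup P i) (lookup Q i) (P⊑Q i)
  where
  mono : ∀ a c → (a ≡ true → c ≡ true) → ⟦ a ⟧ ≤ ⟦ c ⟧
  mono false c h = z≤n
  mono true c h rewrite h refl = ≤-refl

-- The random properties concern sets of size exactly k; this cuts larger sets down and pads smaller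
-- ones to that size.
interpolate : ∀ {n} (P Q : Vec Bool n) k → P ⊑ Q → size P ≤ k → k ≤ size Q →
              ∃ λ W → P ⊑ W × W ⊑ Q × size W ≡ k
interpolate [] [] k P⊑Q lo hi = [] , (λ ()) , (λ ()) , ≤-antisym lo hi
interpolate (p ∷ P) (q ∷ Q) k P⊑Q lo hi
  rewrite size-∷ p P | size-∷ q Q = go p q k P⊑Q lo hi
  where
  tail⊑ : P ⊑ Q
  tail⊑ i = P⊑Q (suc i)
  extend : ∀ {p q k} a → (p ≡ true → a ≡ true) → (a ≡ true → q ≡ true) →
           (∃ λ W → P ⊑ W × W ⊑ Q × size W ≡ k) →
           ∃ λ W → (p ∷ P) ⊑ W × W ⊑ (q ∷ Q) × size W ≡ ⟦ a ⟧ + k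
  extend a pa aq (W , P⊑W , W⊑Q , refl) = a ∷ W ,
    (λ { zero → pa ; (suc i) → P⊑W i }) , (λ { zero → aq ; (suc i) → W⊑Q i }) , size-∷ a W
  go : ∀ p q k → (p ∷ P) ⊑ (q ∷ Q) → ⟦ p ⟧ + size P ≤ k → k ≤ ⟦ q ⟧ + size Q →
       ∃ λ W → (p ∷ P) ⊑ W × W ⊑ (q ∷ Q) × size W ≡ k
  go true false k sub lo hi = contradiction (sub zero refl) λ ()
  go false false k sub lo hi = extend false id id (interpolate P Q k tail⊑ lo hi)
  go true true (suc k) sub lo hi = extend true id id (interpolate P Q k tail⊑ (s≤s⁻¹ lo) (s≤s⁻¹ hi))
  go false true k sub lo hi with k ≤? size Q
  ... | yes k≤ = extend false id (λ _ → refl) (interpolate P Q k tail⊑ lo k≤)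
  ... | no k≰ with k | ≰⇒> k≰ | hi
  ...   | suc k′ | >Q | hi′ = extend true (λ _ → refl) id
           (interpolate P Q k′ tail⊑ (≤-trans (size-mono {P = P} {Q} tail⊑) (s≤s⁻¹ >Q)) (s≤s⁻¹ hi′))

size-⊤ : ∀ n → size (Vec.replicate n true) ≡ n
size-⊤ n = trans (∑-cong (allFin n) λ i → cong ⟦_⟧ (lookup-replicate i true))
  (trans (∑ᶠ-const {n} 1) (*-identityʳ n))

size-⊥ : ∀ n → size (Vec.replicate n false) ≡ 0
size-⊥ n = trans (∑-cong (allFin n) λ i → cong ⟦_⟧ (lookup-replicate i false))
  (trans (∑ᶠ-const {n} 0) (*-zeroʳ n))

⊥⊑ : ∀ {n} (Q : Vec Bool n) → Vec.replicate n false ⊑ Q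
⊥⊑ Q i eq = contradiction (trans (sym (lookup-replicate i false)) eq) λ ()

-- The bit of a pair is in the row of its smaller vertex.  A pair is closed if
-- an earlier row contains both vertices: closed pairs are never made red, and
-- whether a pair is closed does not depend on its own row.
module FromMatrix {n : ℕ} (x : Matrix n) where

  Bit : Fin n → Fin n → Set
  Bit i j = entry x i j ≡ true

  Bit? : ∀ i j → Dec (Bit i j)
  Bit? i j = entry x i j Bool.≟ true

  Edge Closed Red Common : Fin n → Fin n → Set
  Edge i j = (i Fin.< j × Bit i j) ⊎ (j Fin.< i × Bit j i)
  Closed i j = ∃ λ w → w Fin.< i × w Fin.< j × Bit w i × Bit w j
  Red i j = Edge i j × ¬ Closed i j
  Common i j = ∃ λ w → Edge w i × Edge w j

  Edge? : ∀ i j → Dec (Edge i j)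
  Edge? i j = ((i Fin.<? j) ×-dec Bit? i j) ⊎-dec ((j Fin.<? i) ×-dec Bit? j i)

  Closed? : ∀ i j → Dec (Closed i j)
  Closed? i j = Fin.any? λ w → (w Fin.<? i) ×-dec (w Fin.<? j) ×-dec Bit? w i ×-dec Bit? w j

  Red? : ∀ i j → Dec (Red i j)
  Red? i j = Edge? i j ×-dec ¬? (Closed? i j)

  Common? : ∀ i j → Dec (Common i j)
  Common? i j = Fin.any? λ w → Edge? w i ×-dec Edge? w j

  Edge-sym : ∀ {i j} → Edge i j → Edge j i
  Edge-sym = swap

  Red-sym : ∀ {i j} → Red i j → Red j i
  Red-sym (e , ¬c) = Edge-sym e , λ (w , w<j , w<i , wj , wi) → ¬c (w , w<i , w<j , wi , wj)

  Common-sym : ∀ {i j} → Common i j → Common j i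
  Common-sym (w , wi , wj) = w , wj , wi

  Bit-from-smaller : ∀ {i j} → i Fin.< j → Edge i j → Bit i j
  Bit-from-smaller i<j (inj₁ (_ , ij)) = ij
  Bit-from-smaller i<j (inj₂ (j<i , _)) = contradiction i<j (Fin.<-asym j<i)

  private
    closes : ∀ {i j k} → i Fin.< j → i Fin.< k → Edge i j → Edge i k → Closed j k
    closes i<j i<k ij ik = _ , i<j , i<k , Bit-from-smaller i<j ij , Bit-from-smaller i<k ik

  Edge⇒≢ : ∀ {i j} → Edge i j → i ≢ j
  Edge⇒≢ (inj₁ (i<j , _)) = Fin.<⇒≢ i<j
  Edge⇒≢ (inj₂ (j<i , _)) = Fin.<⇒≢ j<i ∘ sym

  -- The smallest vertex of a triangle closes the opposite edge.
  Red-triangle-free : ∀ {i j k} → Red i j → Red j k → ¬ Red i k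
  Red-triangle-free {i} {j} {k} (ij , ¬ij) (jk , ¬jk) (ik , ¬ik) with Fin.<-cmp i j | Fin.<-cmp j k | Fin.<-cmp i k
  ... | tri≈ _ i≡j _ | _ | _ = Edge⇒≢ ij i≡j
  ... | _ | tri≈ _ j≡k _ | _ = Edge⇒≢ jk j≡k
  ... | _ | _ | tri≈ _ i≡k _ = Edge⇒≢ ik i≡k
  ... | tri< i<j _ _ | _ | tri< i<k _ _ = ¬jk (closes i<j i<k ij ik)
  ... | tri> _ _ j<i | tri< j<k _ _ | _ = ¬ik (closes j<i j<k (Edge-sym ij) jk)
  ... | _ | tri> _ _ k<j | tri> _ _ k<i = ¬ij (closes k<i k<j (Edge-sym ik) (Edge-sym jk))
  ... | tri< i<j _ _ | tri< j<k _ _ | tri> _ _ k<i = contradiction (Fin.<-trans i<j j<k) (Fin.<-asym k<i)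
  ... | tri> _ _ j<i | tri> _ _ k<j | tri< i<k _ _ = contradiction (Fin.<-trans k<j j<i) (Fin.<-asym i<k)

-- A cell is tested when a 1 there would make a pair of S red; v < u selects the row that holds the
-- bit of the pair.
test? : ∀ {n} (S : Vec Bool n) x (v u : Fin n) →
        Dec (lookup S v ≡ true × lookup S u ≡ true × v Fin.< u × ¬ FromMatrix.Closed x v u)
test? S x v u = (lookup S v Bool.≟ true) ×-dec (lookup S u Bool.≟ true) ×-dec (v Fin.<? u)
  ×-dec ¬? (FromMatrix.Closed? x v u)

test : ∀ {n} → Vec Bool n → Matrix n → Fin n → Fin n → Bool
test S x v u = does (test? S x v u)

-- A vertex w that closes the pair lies below v, so only rows before v are read.
test-causal : ∀ {n} (S : Vec Bool n) → RowCausal (test S)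
test-causal S x x′ v eq u = does-⇔ (mk⇔ (transport {x} {x′} eq) (transport {x′} {x} λ j j<v → sym (eq j j<v))) (test? S x v u) (test? S x′ v u)
  where
  transport : ∀ {x x′} → (∀ j → j Fin.< v → lookup x j ≡ lookup x′ j) →
    lookup S v ≡ true × lookup S u ≡ true × v Fin.< u × ¬ FromMatrix.Closed x v u →
    lookup S v ≡ true × lookup S u ≡ true × v Fin.< u × ¬ FromMatrix.Closed x′ v u
  transport eq (Sv , Su , v<u , open′) = Sv , Su , v<u , λ (w , w<v , w<u , wv , wu) → open′
    (w , w<v , w<u , trans (cong (λ row → lookup row v) (eq w w<v)) wv ,
                     trans (cong (λ row → lookup row u) (eq w w<v)) wu)

⟦_⟧*⟦_⟧≤ : ∀ a c {N} → (a ≡ true → c ≡ true → 1 ≤ N) → ⟦ a ⟧ * ⟦ c ⟧ ≤ N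
⟦ true ⟧*⟦ true ⟧≤ h = h refl refl
⟦ true ⟧*⟦ false ⟧≤ h = z≤n
⟦ false ⟧*⟦ c ⟧≤ h = z≤n

-- Typical matrices: edges and common neighbours in k-sets

module _ {n : ℕ} where

  pairs : Vec Bool n → Vec Bool n → Fin n → Fin n → Bool
  pairs S W i j = lookup S i ∧ lookup W j

  row col : Fin n → Fin n → Fin n → Bool
  row w i j = does (w Fin.≟ i)
  col w i j = does (w Fin.≟ j)

  -- The deterministic properties of the random graph. T bounds the bits per vertex between two
  -- k-sets, D the bits in a row or column, and M the number of tests of a k-set that can all be
  -- missed.
  record Typical (k T D M : ℕ) (x : Matrix n) : Set where
    field
      few-pairs : ∀ S W → size S ≡ k → size W ≡ k → hits (pairs S W) x < k * T
      few-row   : ∀ w → hits (row w) x < D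
      few-col   : ∀ w → hits (col w) x < D
      caught    : ∀ S → size S ≡ k →
                  ¬ ((∀ i j → test S x i j ≡ true → entry x i j ≡ false) × M ≤ ∑∑ λ i j → ⟦ test S x i j ⟧)

  module _ {k T D M : ℕ} {x : Matrix n} (typical : Typical k T D M x) where

    open FromMatrix x
    open Typical typical

    spoke : Vec Bool n → Fin n → Fin n → ℕ
    spoke S w u = ⟦ lookup S u ⟧ * 𝟙 (Edge? w u)

    degreeIn : Vec Bool n → Fin n → ℕ
    degreeIn S w = ∑ᶠ (spoke S w)

    edges : Vec Bool n → Vec Bool n → ℕ
    edges S W = ∑ᶠ λ w → ⟦ lookup W w ⟧ * degreeIn S w

    private
      edge≤ : ∀ w u → 𝟙 (Edge? w u) ≤ ⟦ entry x w u ⟧ + ⟦ entry x u w ⟧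
      edge≤ w u = 𝟙≤ (Edge? w u) λ
        { (inj₁ (_ , wu)) → ≤-trans (≤-reflexive (sym (cong ⟦_⟧ wu))) (m≤m+n _ _)
        ; (inj₂ (_ , uw)) → ≤-trans (≤-reflexive (sym (cong ⟦_⟧ uw))) (m≤n+m _ _) }

    -- The bit of an edge lies in the block W × S or in S × W, according to which end is smaller,
    -- and each block has fewer than k T ones.
    edges≤ : ∀ S W → size S ≡ k → size W ≡ k → edges S W < 2 * (k * T)
    edges≤ S W S≡k W≡k = begin-strict
      edges S W
        ≡⟨ ∑-cong (allFin n) (λ w → sym (∑-*ˡ (allFin n) ⟦ lookup W w ⟧ (spoke S w))) ⟩
      ∑∑ (λ w u → ⟦ lookup W w ⟧ * spoke S w u)
        ≤⟨ ∑∑-mono (λ w u → pointwise w u (lookup W w) (lookup S u)) ⟩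
      ∑∑ (λ w u → h (pairs W S) w u + h (pairs S W) u w) ≡⟨ ∑∑-+ (h (pairs W S)) (λ w u → h (pairs S W) u w) ⟩
      hits (pairs W S) x + ∑∑ (λ w u → h (pairs S W) u w)
        ≡⟨ cong (hits (pairs W S) x +_) (∑-swap (allFin n) (allFin n) _) ⟩
      hits (pairs W S) x + hits (pairs S W) x      <⟨ +-mono-< (few-pairs W S W≡k S≡k) (few-pairs S W S≡k W≡k) ⟩
      k * T + k * T                                ≡⟨ cong (k * T +_) (+-identityʳ (k * T)) ⟨
      2 * (k * T)                                  ∎
      where
      open ≤-Reasoning
      h : (Fin n → Fin n → Bool) → Fin n → Fin n → ℕ
      h c i j = ⟦ c i j ∧ entry x i j ⟧
      pointwise : ∀ w u a c → ⟦ a ⟧ * (⟦ c ⟧ * 𝟙 (Edge? w u)) ≤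
                  ⟦ (a ∧ c) ∧ entry x w u ⟧ + ⟦ (c ∧ a) ∧ entry x u w ⟧
      pointwise w u false c = z≤n
      pointwise w u true false = z≤n
      pointwise w u true true = ≤-trans (≤-reflexive (lemma (𝟙 (Edge? w u)))) (edge≤ w u)
        where
        lemma : ∀ a → 1 * (1 * a) ≡ a
        lemma = solve-∀

    degreeIn≤ : ∀ S w → degreeIn S w ≤ 2 * D
    degreeIn≤ S w = begin
      degreeIn S w
        ≤⟨ ∑-mono (allFin n) (λ u → pointwise u (lookup S u)) ⟩
      ∑ᶠ (λ u → ⟦ entry x w u ⟧ + ⟦ entry x u w ⟧)           ≡⟨ ∑-+ (allFin n) _ _ ⟩
      ∑ᶠ (λ u → ⟦ entry x w u ⟧) + ∑ᶠ (λ u → ⟦ entry x u w ⟧) ≤⟨ +-mono-≤ row≤ col≤ ⟩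
      hits (row w) x + hits (col w) x                        ≤⟨ +-mono-≤ (<⇒≤ (few-row w)) (<⇒≤ (few-col w)) ⟩
      D + D                                                  ≡⟨ cong (D +_) (+-identityʳ D) ⟨
      2 * D                                                  ∎
      where
      open ≤-Reasoning
      pointwise : ∀ u c → ⟦ c ⟧ * 𝟙 (Edge? w u) ≤ ⟦ entry x w u ⟧ + ⟦ entry x u w ⟧
      pointwise u false = z≤n
      pointwise u true = ≤-trans (≤-reflexive (*-identityˡ _)) (edge≤ w u)
      true≡ : true ≡ does (w Fin.≟ w)
      true≡ = sym (dec-true (w Fin.≟ w) refl)
      row≤ : ∑ᶠ (λ u → ⟦ entry x w u ⟧) ≤ hits (row w) x
      row≤ = ≤-trans (≤-reflexive (∑-cong (allFin n) λ u → cong (λ t → ⟦ t ∧ entry x w u ⟧) true≡))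
        (∑ᶠ-≥ (λ i → ∑ᶠ λ j → ⟦ row w i j ∧ entry x i j ⟧) w)
      col≤ : ∑ᶠ (λ u → ⟦ entry x u w ⟧) ≤ hits (col w) x
      col≤ = ∑-mono (allFin n) λ i → ≤-trans (≤-reflexive (cong (λ t → ⟦ t ∧ entry x i w ⟧) true≡))
        (∑ᶠ-≥ (λ j → ⟦ col w i j ∧ entry x i j ⟧) w)

    heavy : Vec Bool n → Vec Bool n
    heavy S = Vec.tabulate λ w → does (2 * T ≤? degreeIn S w)

    -- The first term is for vertices with fewer than 2T neighbours in S, the second for the others:
    -- degree at most 2D times total degree at most 2kT.
    cherryBound : ℕ
    cherryBound = n * (2 * T * (2 * T)) + 2 * D * (2 * (k * T))

    -- Vertices with at least 2T neighbours in S: there are fewer than k of them,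
    -- as k of them would span too many edges with S, and then together they
    -- have at most 2kT edges to S.
    cherries≤ : ∀ S → size S ≡ k → k ≤ n → ∑ᶠ (λ w → degreeIn S w * degreeIn S w) ≤ cherryBound
    cherries≤ S S≡k k≤n with k ≤? size (heavy S)
    ... | yes k≤ with interpolate (Vec.replicate n false) (heavy S) k (⊥⊑ (heavy S)) (≤-trans (≤-reflexive (size-⊥ n)) z≤n) k≤
    ...   | W , _ , W⊑ , W≡k = contradiction (edges≤ S W S≡k W≡k) (≤⇒≯ (begin
      2 * (k * T)                             ≡⟨ lemma k T ⟩
      k * (2 * T)                             ≡⟨ cong (_* (2 * T)) W≡k ⟨
      size W * (2 * T)                        ≡⟨ ∑-*ʳ (allFin n) (2 * T) _ ⟨
      ∑ᶠ (λ w → ⟦ lookup W w ⟧ * (2 * T))     ≤⟨ ∑-mono (allFin n) (λ w → pointwise w (lookup W w) (W⊑ w)) ⟩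
      edges S W                               ∎))
      where
      open ≤-Reasoning
      lemma : ∀ k T → 2 * (k * T) ≡ k * (2 * T)
      lemma = solve-∀
      pointwise : ∀ w a → (a ≡ true → lookup (heavy S) w ≡ true) → ⟦ a ⟧ * (2 * T) ≤ ⟦ a ⟧ * degreeIn S w
      pointwise w false _ = z≤n
      pointwise w true h = *-monoʳ-≤ 1
        (does⇒ (2 * T ≤? degreeIn S w) (trans (sym (lookup∘tabulate _ w)) (h refl)))
    -- The heavy set is padded to exactly k vertices, so that `edges≤` applies to it.
    cherries≤ S S≡k k≤n | no k≰ with interpolate (heavy S) (Vec.replicate n true) k (λ i _ → lookup-replicate i true)
                                       (<⇒≤ (≰⇒> k≰)) (≤-trans k≤n (≤-reflexive (sym (size-⊤ n))))
    ... | W , heavy⊑W , _ , W≡k = begin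
      ∑ᶠ (λ w → d w * d w)                                            ≤⟨ ∑-mono (allFin n) pointwise ⟩
      ∑ᶠ (λ w → 2 * T * (2 * T) + 2 * D * (⟦ lookup W w ⟧ * d w))     ≡⟨ ∑-+ (allFin n) _ _ ⟩
      ∑ᶠ {n} (λ _ → 2 * T * (2 * T)) + ∑ᶠ (λ w → 2 * D * (⟦ lookup W w ⟧ * d w))
        ≡⟨ cong₂ _+_ (∑ᶠ-const {n} _) (∑-*ˡ (allFin n) (2 * D) _) ⟩
      n * (2 * T * (2 * T)) + 2 * D * edges S W
        ≤⟨ +-monoʳ-≤ _ (*-monoʳ-≤ (2 * D) (<⇒≤ (edges≤ S W S≡k W≡k))) ⟩
      cherryBound ∎
      where
      open ≤-Reasoning
      d = degreeIn S
      pointwise : ∀ w → d w * d w ≤ 2 * T * (2 * T) + 2 * D * (⟦ lookup W w ⟧ * d w)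
      pointwise w with 2 * T ≤? d w in eq
      ... | yes p rewrite heavy⊑W w (trans (lookup∘tabulate _ w) (cong does eq)) = begin
        d w * d w                  ≤⟨ *-monoˡ-≤ (d w) (degreeIn≤ S w) ⟩
        2 * D * d w                ≡⟨ cong (2 * D *_) (*-identityˡ (d w)) ⟨
        2 * D * (1 * d w)          ≤⟨ m≤n+m _ _ ⟩
        _                          ∎
      ... | no p = ≤-trans (*-mono-≤ (<⇒≤ (≰⇒> p)) (<⇒≤ (≰⇒> p))) (m≤m+n _ _)

    -- Of the k² ordered pairs, k are diagonal, those with a common neighbour w number at most the
    -- sum of the squared degrees into S, and f accounts for the rest.
    count-pairs : ∀ S → size S ≡ k → k ≤ n → (f : Fin n → Fin n → ℕ) →
      (∀ v u → v ≢ u → lookup S v ≡ true → lookup S u ≡ true → ¬ Common v u → 1 ≤ f v u) →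
      k * k ≤ k + ∑∑ f + cherryBound
    count-pairs S S≡k k≤n f h = begin
      k * k                                                  ≡⟨ cong₂ _*_ (sym S≡k) (sym S≡k) ⟩
      size S * size S
        ≡⟨ ∑ᶠ-* (λ i → ⟦ lookup S i ⟧) (λ i → ⟦ lookup S i ⟧) ⟩
      ∑∑ (λ v u → ⟦ lookup S v ⟧ * ⟦ lookup S u ⟧)           ≤⟨ ∑∑-mono pointwise ⟩
      ∑∑ (λ v u → δ v u + f v u + cherry v u)                ≡⟨ ∑∑-+ (λ v u → δ v u + f v u) cherry ⟩
      ∑∑ (λ v u → δ v u + f v u) + ∑∑ cherry                 ≡⟨ cong (_+ ∑∑ cherry) (∑∑-+ δ f) ⟩
      ∑∑ δ + ∑∑ f + ∑∑ cherry                                ≡⟨ cong₂ (λ a c → a + ∑∑ f + c) δ≡ cherry≡ ⟩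
      k + ∑∑ f + ∑ᶠ (λ w → degreeIn S w * degreeIn S w)      ≤⟨ +-monoʳ-≤ _ (cherries≤ S S≡k k≤n) ⟩
      k + ∑∑ f + cherryBound                                 ∎
      where
      open ≤-Reasoning
      δ cherry : Fin n → Fin n → ℕ
      δ v u = ⟦ lookup S v ⟧ * 𝟙 (v Fin.≟ u)
      cherry v u = ∑ᶠ λ w → spoke S w v * spoke S w u
      δ≡ : ∑∑ δ ≡ k
      δ≡ = trans (∑-cong (allFin n) λ v → trans (∑-*ˡ (allFin n) ⟦ lookup S v ⟧ _)
             (trans (cong (⟦ lookup S v ⟧ *_) (∑ᶠ-δ v)) (*-identityʳ _))) S≡k
      cherry≡ : ∑∑ cherry ≡ ∑ᶠ (λ w → degreeIn S w * degreeIn S w)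
      cherry≡ = trans (∑-cong (allFin n) λ v → ∑-swap (allFin n) (allFin n) _)
        (trans (∑-swap (allFin n) (allFin n) _)
          (∑-cong (allFin n) λ w → sym (∑ᶠ-* (spoke S w) (spoke S w))))
      pointwise : ∀ v u → ⟦ lookup S v ⟧ * ⟦ lookup S u ⟧ ≤ δ v u + f v u + cherry v u
      pointwise v u = ⟦ lookup S v ⟧*⟦ lookup S u ⟧≤ body
        where
        body : lookup S v ≡ true → lookup S u ≡ true → 1 ≤ δ v u + f v u + cherry v u
        body Sv Su with v Fin.≟ u in δeq | Common? v u
        ... | yes v≡u | _ rewrite Sv = s≤s z≤n
        ... | no v≢u | no ¬cm = ≤-trans (h v u v≢u Sv Su ¬cm) (≤-trans (m≤n+m _ _) (m≤m+n _ (cherry v u)))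
        ... | no v≢u | yes (w , wv , wu) = ≤-trans (≤-trans (≤-reflexive (sym spoke≡))
                (∑ᶠ-≥ (λ w → spoke S w v * spoke S w u) w)) (m≤n+m _ _)
          where
          spoke≡ : spoke S w v * spoke S w u ≡ 1
          spoke≡ rewrite Sv | Su | 𝟙-yes (Edge? w v) wv | 𝟙-yes (Edge? w u) wu = refl

    module _ (k≤n : k ≤ n) where

      -- A tested bit equal to 1 would be a red edge, so all tests miss. Each pair without a common
      -- neighbour is tested in one of its two orders, which makes at least M tests.
      red-free-small : k + 2 * M + cherryBound ≤ k * k → ∀ S → size S ≡ k →
                       ¬ (∀ i j → lookup S i ≡ true → lookup S j ≡ true → ¬ Red i j)
      red-free-small room S S≡k no-red = caught S S≡k (missed , *-cancelˡ-≤ 2 (+-cancelˡ-≤ k _ _ (+-cancelʳ-≤ cherryBound _ _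
        (≤-trans room (≤-trans (count-pairs S S≡k k≤n (λ v u → ⟦ test S x v u ⟧ + ⟦ test S x u v ⟧) open-pair)
          (≤-reflexive (cong (λ z → k + z + cherryBound) twice)))))))
        where
        missed : ∀ i j → test S x i j ≡ true → entry x i j ≡ false
        missed i j t with entry x i j in eq | does⇒ (test? S x i j) t
        ... | true | Si , Sj , i<j , open′ = contradiction (inj₁ (i<j , eq) , open′) (no-red i j Si Sj)
        ... | false | _ = refl
        twice : ∑∑ (λ v u → ⟦ test S x v u ⟧ + ⟦ test S x u v ⟧) ≡ 2 * ∑∑ (λ v u → ⟦ test S x v u ⟧)
        twice = trans (∑∑-+ (λ v u → ⟦ test S x v u ⟧) (λ v u → ⟦ test S x u v ⟧))
          (cong (∑∑ (λ v u → ⟦ test S x v u ⟧) +_) (trans (∑-swap (allFin n) (allFin n) _) (sym (+-identityʳ _))))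
        closed⇒common : ∀ {v u} → Closed v u → Common v u
        closed⇒common (w , w<v , w<u , wv , wu) = w , inj₁ (w<v , wv) , inj₁ (w<u , wu)
        open-pair : ∀ v u → v ≢ u → lookup S v ≡ true → lookup S u ≡ true → ¬ Common v u →
                    1 ≤ ⟦ test S x v u ⟧ + ⟦ test S x u v ⟧
        open-pair v u v≢u Sv Su ¬cm with Fin.<-cmp v u
        ... | tri< v<u _ _ = ≤-trans (≤-reflexive (sym (𝟙-yes (test? S x v u) (Sv , Su , v<u , ¬cm ∘ closed⇒common)))) (m≤m+n _ _)
        ... | tri≈ _ v≡u _ = contradiction v≡u v≢u
        ... | tri> _ _ u<v = ≤-trans (≤-reflexive (sym (𝟙-yes (test? S x u v) (Su , Sv , u<v , ¬cm ∘ Common-sym ∘ closed⇒common)))) (m≤n+m _ _)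

      -- Without blue, every pair without a common neighbour is red, hence an edge; `room` makes
      -- these pairs more numerous than the edges that S can span.
      blue-free-small : k + 2 * (k * T) + cherryBound ≤ k * k → ∀ S → size S ≡ k →
                        ¬ (∀ i j → lookup S i ≡ true → lookup S j ≡ true → i ≢ j → Red i j ⊎ Common i j)
      blue-free-small room S S≡k no-blue = contradiction (edges≤ S S S≡k S≡k)
        (≤⇒≯ (+-cancelˡ-≤ k _ _ (+-cancelʳ-≤ cherryBound _ _ (≤-trans room
          (≤-trans (count-pairs S S≡k k≤n (λ v u → ⟦ lookup S v ⟧ * spoke S v u) red)
            (≤-reflexive (cong (λ z → k + z + cherryBound) (∑-cong (allFin n) λ v → ∑-*ˡ (allFin n) ⟦ lookup S v ⟧ _))))))))
        where
        red : ∀ v u → v ≢ u → lookup S v ≡ true → lookup S u ≡ true → ¬ Common v u →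
              1 ≤ ⟦ lookup S v ⟧ * spoke S v u
        red v u v≢u Sv Su ¬cm with no-blue v u Sv Su v≢u
        ... | inj₂ cm = contradiction cm ¬cm
        ... | inj₁ (vu , _) rewrite Sv | Su | 𝟙-yes (Edge? v u) vu = ≤-refl

-- Existence of a typical matrix

∑-k-subsets : ∀ n k → ∑ (subsets n) (λ S → 𝟙 (size S ≟ k)) ≤ n ^ k
∑-k-subsets zero zero = ≤-refl
∑-k-subsets zero (suc k) = z≤n
∑-k-subsets (suc n) k = ≤-trans (≤-reflexive (trans (∑-subsets-suc {n} λ S → 𝟙 (size S ≟ k))
  (cong₂ _+_ (∑-cong (subsets n) λ S → cong (λ z → 𝟙 (z ≟ k)) (size-∷ true S))
             (∑-cong (subsets n) λ S → cong (λ z → 𝟙 (z ≟ k)) (size-∷ false S))))) (go k)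
  where
  open ≤-Reasoning
  go : ∀ k → ∑ (subsets n) (λ S → 𝟙 (suc (size S) ≟ k)) + ∑ (subsets n) (λ S → 𝟙 (size S ≟ k)) ≤ suc n ^ k
  go zero = ≤-trans (+-monoˡ-≤ _ (≤-reflexive (trans (∑-const (subsets n) 0) (*-zeroʳ (length (subsets n))))))
    (∑-k-subsets n zero)
  go (suc k) = begin
    ∑ (subsets n) (λ S → 𝟙 (suc (size S) ≟ suc k)) + ∑ (subsets n) (λ S → 𝟙 (size S ≟ suc k))
      ≤⟨ +-mono-≤ (∑-k-subsets n k) (∑-k-subsets n (suc k)) ⟩
    suc n * n ^ k      ≤⟨ *-monoʳ-≤ (suc n) (^-monoˡ-≤ k (n≤1+n n)) ⟩
    suc n ^ suc k      ∎

-- With n ≤ 2^L a union over k-sets costs 2^(L k) and one over vertices 2^L. The choice k = 4 m l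
-- makes the mean k²/m of a block equal to 4 l k, and M = m k l equal to k²/4.
module Existence (q h n s L : ℕ) (m≡2h : suc q ≡ 2 * h) (n≤ms : n ≤ suc q * s) (n≤2^L : n ≤ 2 ^ L)
                 (k : ℕ) (3≤k : 3 ≤ k) (k≡4ml : k ≡ suc q * (4 * suc L)) .{{_ : NonZero q}} where

  open Random q n

  private
    l = suc L
    -- Twice the bound s on the mean n/m, plus L for the union over the vertices, plus 3 for a final
    -- probability of 1/8.
    D = 2 * s + (L + 3)
    M = m * (k * l)

    ratio : suc m ^ m ≤ 4 * m ^ m
    ratio = subst (λ m → suc m ^ m ≤ 4 * m ^ m) (sym m≡2h) ([1+1/m]^m≤4 h)

    Rare-≤ : ∀ {β β′ f} → β ≤ β′ → Rare β′ f → Rare β f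
    Rare-≤ {f = f} b≤ = ≤-trans (*-monoˡ-≤ (∑ matrices f) (^-monoʳ-≤ 2 b≤))

    union-k-subsets : ∀ (f : Vec Bool n → Matrix n → ℕ) β → (∀ S → size S ≡ k → Rare (L * k + β) (f S)) →
                      Rare β (λ x → ∑ (subsets n) λ S → 𝟙 (size S ≟ k) * f S x)
    union-k-subsets f β rare = union-bound (subsets n) (λ S → 𝟙 (size S ≟ k)) _ (L * k) β
      (≤-trans (∑-k-subsets n k) (≤-trans (^-monoˡ-≤ k n≤2^L) (≤-reflexive (^-*-assoc 2 L k)))) each
      where
      each : ∀ S → 2 ^ (L * k + β) * ∑ matrices (λ x → 𝟙 (size S ≟ k) * f S x) ≤ 𝟙 (size S ≟ k) * total
      each S = ≤-trans (≤-reflexive (trans (cong (2 ^ (L * k + β) *_) (∑-*ˡ matrices (𝟙 (size S ≟ k)) (f S)))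
          (lemma (2 ^ (L * k + β)) (𝟙 (size S ≟ k)) _)))
        (𝟙*≤ (size S ≟ k) λ S≡k → ≤-trans (rare S S≡k) (≤-reflexive (sym
          (trans (cong (_* total) (𝟙-yes (size S ≟ k) S≡k)) (*-identityˡ total)))))
        where
        lemma : ∀ a c d → a * (c * d) ≡ c * (a * d)
        lemma = solve-∀

    union-vertices : ∀ (f : Fin n → Matrix n → ℕ) β → (∀ w → Rare (L + β) (f w)) →
                     Rare β (λ x → ∑ᶠ λ w → f w x)
    union-vertices f β rare = union-bound (allFin n) (λ _ → 1) f L β
      (≤-trans (≤-reflexive (trans (∑ᶠ-const {n} 1) (*-identityʳ n))) n≤2^L)
      λ w → ≤-trans (rare w) (≤-reflexive (sym (*-identityˡ total)))

    dense thick-row thick-col uncaught : Matrix n → ℕ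
    dense x = ∑ (subsets n) λ S → 𝟙 (size S ≟ k) *
      ∑ (subsets n) λ W → 𝟙 (size W ≟ k) * 𝟙 (2 * (4 * l * k) + 2 * l * k ≤? hits (pairs S W) x)
    thick-row x = ∑ᶠ λ w → 𝟙 (D ≤? hits (row w) x)
    thick-col x = ∑ᶠ λ w → 𝟙 (D ≤? hits (col w) x)
    uncaught x = ∑ (subsets n) λ S → 𝟙 (size S ≟ k) *
      𝟙 (Missed? (test S) (test-causal S) x ×-dec (M ≤? tests (test S) (test-causal S) x))

    -- The union over two k-sets costs 2 L k, which the excess 2 l k = 2 L k + 2 k covers. The
    -- threshold 2 (4 l k) + 2 l k = 10 l k is the origin of T = 10 l.
    dense-rare : Rare 3 dense
    dense-rare = union-k-subsets _ 3 λ S S≡k → union-k-subsets _ (L * k + 3) λ W W≡k →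
      Rare-≤ {β = L * k + (L * k + 3)} {β′ = 2 * l * k} (≤-trans (+-monoʳ-≤ (L * k) (+-monoʳ-≤ (L * k) (≤-trans 3≤k (m≤n+m k k)))) (≤-reflexive (lemma L k)))
        (tail-rare ratio (pairs S W) (4 * l * k) (2 * l * k) (≤-reflexive (begin
          ∑∑ (λ i j → ⟦ pairs S W i j ⟧)
            ≡⟨ ∑-cong (allFin n) (λ i → ∑-cong (allFin n) λ j → ⟦∧⟧ (lookup S i) (lookup W j)) ⟩
          ∑∑ (λ i j → ⟦ lookup S i ⟧ * ⟦ lookup W j ⟧)
            ≡⟨ ∑ᶠ-* (λ i → ⟦ lookup S i ⟧) (λ j → ⟦ lookup W j ⟧) ⟨
          size S * size W                                  ≡⟨ cong₂ _*_ S≡k W≡k ⟩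
          k * k                                            ≡⟨ cong (_* k) k≡4ml ⟩
          m * (4 * l) * k                                  ≡⟨ *-assoc m (4 * l) k ⟩
          m * (4 * l * k)                                  ∎)))
      where
      open ≡-Reasoning
      lemma : ∀ L k → L * k + (L * k + (k + k)) ≡ 2 * (1 + L) * k
      lemma = solve-∀
      ⟦∧⟧ : ∀ a c → ⟦ a ∧ c ⟧ ≡ ⟦ a ⟧ * ⟦ c ⟧
      ⟦∧⟧ true c = sym (+-identityʳ ⟦ c ⟧)
      ⟦∧⟧ false c = refl

    row-rare : Rare 3 thick-row
    row-rare = union-vertices _ 3 λ w → tail-rare ratio (row w) s (L + 3) (≤-trans (≤-reflexive (begin
      ∑∑ (λ i j → ⟦ row w i j ⟧)          ≡⟨ ∑-cong (allFin n) (λ i → ∑ᶠ-const {n} _) ⟩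
      ∑ᶠ (λ i → n * 𝟙 (w Fin.≟ i))        ≡⟨ ∑-*ˡ (allFin n) n _ ⟩
      n * ∑ᶠ (λ i → 𝟙 (w Fin.≟ i))        ≡⟨ cong (n *_) (∑ᶠ-δ w) ⟩
      n * 1                               ≡⟨ *-identityʳ n ⟩
      n                                   ∎)) n≤ms)
      where open ≡-Reasoning

    col-rare : Rare 3 thick-col
    col-rare = union-vertices _ 3 λ w → tail-rare ratio (col w) s (L + 3) (≤-trans (≤-reflexive (begin
      ∑∑ (λ i j → ⟦ col w i j ⟧)          ≡⟨ ∑-cong (allFin n) (λ i → ∑ᶠ-δ w) ⟩
      ∑ᶠ {n} (λ i → 1)                    ≡⟨ ∑ᶠ-const {n} 1 ⟩
      n * 1                               ≡⟨ *-identityʳ n ⟩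
      n                                   ∎)) n≤ms)
      where open ≡-Reasoning

    -- Missing M = m (k l) tests has probability at most 2^-(k l), and k l = L k + k beats the union
    -- over the k-sets.
    uncaught-rare : Rare 3 uncaught
    uncaught-rare = union-k-subsets _ 3 λ S S≡k →
      Rare-≤ {β = L * k + 3} {β′ = k * l} (≤-trans (+-monoʳ-≤ (L * k) 3≤k) (≤-reflexive (lemma L k)))
        (missed-rare (test S) (test-causal S) (k * l))
      where
      lemma : ∀ L k → L * k + k ≡ k * (1 + L)
      lemma = solve-∀

    bad : Matrix n → ℕ
    bad x = dense x + thick-row x + thick-col x + uncaught x

    -- Four contributions, each of mean at most 1/8.
    bad-average : ∑ matrices bad < total
    bad-average = *-cancelˡ-< 8 _ _ (begin-strict
      8 * ∑ matrices bad
        ≡⟨ cong (8 *_) (trans (∑-+ matrices _ uncaught) (cong (_+ ∑ matrices uncaught)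
             (trans (∑-+ matrices _ thick-col) (cong (_+ ∑ matrices thick-col) (∑-+ matrices dense thick-row))))) ⟩
      8 * (∑ matrices dense + ∑ matrices thick-row + ∑ matrices thick-col + ∑ matrices uncaught)
        ≡⟨ lemma (∑ matrices dense) (∑ matrices thick-row) (∑ matrices thick-col) (∑ matrices uncaught) ⟩
      8 * ∑ matrices dense + 8 * ∑ matrices thick-row + 8 * ∑ matrices thick-col + 8 * ∑ matrices uncaught
        ≤⟨ +-mono-≤ (+-mono-≤ (+-mono-≤ dense-rare row-rare) col-rare) uncaught-rare ⟩
      total + total + total + total   ≡⟨ lemma′ total ⟩
      4 * total                       <⟨ *-monoˡ-< total {{>-nonZero total>0}} (≤ᵇ⇒≤ 5 8 tt) ⟩
      8 * total                       ∎)
      where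
      open ≤-Reasoning
      lemma : ∀ a c d e → 8 * (a + c + d + e) ≡ 8 * a + 8 * c + 8 * d + 8 * e
      lemma = solve-∀
      lemma′ : ∀ a → a + a + a + a ≡ 4 * a
      lemma′ = solve-∀
      total>0 : 0 < total
      total>0 = subst (0 <_) (sym total≡) (m^n>0 (m ^ n) {{m^n≢0 m n}} n)

  module _ (x : Matrix n) (bad≡0 : bad x ≡ 0) where

    bad≡0⇒typical : Typical k (10 * l) D M x
    bad≡0⇒typical = record
      { few-pairs = λ S W S≡k W≡k → ≤-trans (≰⇒> (𝟙≡0⇒¬ (2 * (4 * l * k) + 2 * l * k ≤? hits (pairs S W) x)
          (zero-at (λ W → 𝟙 (2 * (4 * l * k) + 2 * l * k ≤? hits (pairs S W) x))
            (zero-at (λ S → ∑ (subsets n) λ W → 𝟙 (size W ≟ k) * 𝟙 (2 * (4 * l * k) + 2 * l * k ≤? hits (pairs S W) x))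
              dense≡0 S S≡k) W W≡k))) (≤-reflexive (lemma l k))
      ; few-row = λ w → ≰⇒> (𝟙≡0⇒¬ (D ≤? hits (row w) x)
          (n≤0⇒n≡0 (≤-trans (∑ᶠ-≥ (λ w → 𝟙 (D ≤? hits (row w) x)) w) (≤-reflexive row≡0))))
      ; few-col = λ w → ≰⇒> (𝟙≡0⇒¬ (D ≤? hits (col w) x)
          (n≤0⇒n≡0 (≤-trans (∑ᶠ-≥ (λ w → 𝟙 (D ≤? hits (col w) x)) w) (≤-reflexive col≡0))))
      ; caught = λ S S≡k → 𝟙≡0⇒¬ (Missed? (test S) (test-causal S) x ×-dec (M ≤? tests (test S) (test-causal S) x))
          (zero-at (λ S → 𝟙 (Missed? (test S) (test-causal S) x ×-dec (M ≤? tests (test S) (test-causal S) x)))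
            uncaught≡0 S S≡k)
      }
      where
      summands≡0 : ∀ a c d e → a + c + d + e ≡ 0 → a ≡ 0 × c ≡ 0 × d ≡ 0 × e ≡ 0
      summands≡0 zero zero zero zero _ = refl , refl , refl , refl
      zeros : dense x ≡ 0 × thick-row x ≡ 0 × thick-col x ≡ 0 × uncaught x ≡ 0
      zeros = summands≡0 (dense x) (thick-row x) (thick-col x) (uncaught x) bad≡0
      dense≡0 = proj₁ zeros
      row≡0 = proj₁ (proj₂ zeros)
      col≡0 = proj₁ (proj₂ (proj₂ zeros))
      uncaught≡0 = proj₂ (proj₂ (proj₂ zeros))
      zero-at : ∀ (f : Vec Bool n → ℕ) → ∑ (subsets n) (λ S → 𝟙 (size S ≟ k) * f S) ≡ 0 →
                ∀ S → size S ≡ k → f S ≡ 0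
      zero-at f ∑≡0 S S≡k = n≤0⇒n≡0 (≤-trans (≤-reflexive (sym (trans (cong (_* f S) (𝟙-yes (size S ≟ k) S≡k)) (*-identityˡ (f S)))))
        (≤-trans (≤∑-subsets (λ S → 𝟙 (size S ≟ k) * f S) S) (≤-reflexive ∑≡0)))
      lemma : ∀ l k → 2 * (4 * l * k) + 2 * l * k ≡ k * (10 * l)
      lemma = solve-∀

  typical : ∃ (Typical k (10 * l) D M)
  typical = let x , bad≡0 = ∑<length⇒∃0 matrices bad bad-average in x , bad≡0⇒typical x bad≡0

-- Colorings without rrr and rrb

∣∣≡size : ∀ {n} (S : Subset n) → ∣ S ∣ ≡ size S
∣∣≡size [] = refl
∣∣≡size (true ∷ S) = trans (cong suc (∣∣≡size S)) (sym (size-∷ true S))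
∣∣≡size (false ∷ S) = trans (∣∣≡size S) (sym (size-∷ false S))

isRed? : ∀ c → Dec (c ≡ r)
isRed? r = yes refl
isRed? b = no λ ()
isRed? y = no λ ()

Cherries : ∀ {n} → Coloring n → Set
Cherries c = ∀ i j k → i ≢ j → j ≢ k → i ≢ k → color c i j ≡ r → color c j k ≡ r → color c i k ≡ y

Forb⇒Cherries : ∀ {n} (c : Coloring n) → Forb n rrr,rrb c → Cherries c
Forb⇒Cherries c forb i j k i≢j j≢k i≢k ij jk = go (color c i k) refl
  where
  avoided : ∀ {d} → color c i k ≡ d → ¬ Any (pattern₃ r r d ~_) rrr,rrb
  avoided refl a = forb i j k i≢j j≢k i≢k (subst₂ (λ d e → Any (pattern₃ d e (color c i k) ~_) rrr,rrb) (sym ij) (sym jk) a)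
  go : ∀ d → color c i k ≡ d → color c i k ≡ y
  go y eq = eq
  go r eq = contradiction (here ↭-refl) (avoided eq)
  go b eq = contradiction (there (here ↭-refl)) (avoided eq)

-- Among patterns, exactly rrr and rrb have rank sum at most 1.
rank : Color → ℕ
rank r = 0
rank b = 1
rank y = 2

Cherries⇒Forb : ∀ {n} (c : Coloring n) → Cherries c → Forb n rrr,rrb c
Cherries⇒Forb {n} c cherries i j k i≢j j≢k i≢k a =
  go (color c i j) (color c j k) (color c i k) refl refl refl (low a)
  where
  low : ∀ {t} → Any (t ~_) rrr,rrb → rank (Pattern.c₁ t) + (rank (Pattern.c₂ t) + rank (Pattern.c₃ t)) ≤ 1
  low {pattern₃ c₁ c₂ c₃} a = subst (_≤ 1) (cong (λ z → rank c₁ + (rank c₂ + z)) (+-identityʳ (rank c₃))) (bound a)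
    where
    bound : Any (pattern₃ c₁ c₂ c₃ ~_) rrr,rrb → sum (map rank (c₁ ∷ c₂ ∷ c₃ ∷ [])) ≤ 1
    bound (here p) = ≤-trans (≤-reflexive (sum-↭ (map⁺ rank p))) z≤n
    bound (there (here p)) = ≤-reflexive (sum-↭ (map⁺ rank p))
  clash : ∀ {i j k} → i ≢ j → j ≢ k → i ≢ k → color c i j ≡ r → color c j k ≡ r →
          ∀ {d} → color c i k ≡ d → ¬ (d ≢ y)
  clash i≢j j≢k i≢k ij jk ik d≢y = d≢y (trans (sym ik) (cherries _ _ _ i≢j j≢k i≢k ij jk))
  flip : ∀ {i j d} → color c i j ≡ d → color c j i ≡ d
  flip {i} {j} eq = trans (color-sym c j i) eq
  go : ∀ d e f → color c i j ≡ d → color c j k ≡ e → color c i k ≡ f → ¬ (rank d + (rank e + rank f) ≤ 1)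
  go r r r ij jk ik _ = clash i≢j j≢k i≢k ij jk ik λ ()
  go r r b ij jk ik _ = clash i≢j j≢k i≢k ij jk ik λ ()
  go r b r ij jk ik _ = clash (i≢j ∘ sym) i≢k j≢k (flip ij) ik jk λ ()
  go b r r ij jk ik _ = clash i≢k (j≢k ∘ sym) i≢j ik (flip jk) ij λ ()
  go r r y _ _ _ (s≤s ())
  go r b b _ _ _ (s≤s ())
  go r b y _ _ _ (s≤s ())
  go r y r _ _ _ (s≤s ())
  go r y b _ _ _ (s≤s ())
  go r y y _ _ _ (s≤s ())
  go b r b _ _ _ (s≤s ())
  go b r y _ _ _ (s≤s ())
  go b b _ _ _ _ (s≤s ())
  go b y _ _ _ _ (s≤s ())
  go y _ _ _ _ _ (s≤s ())

Misses : ∀ {n} → Coloring n → Color → Subset n → Set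
Misses c d S = ∀ i j → lookup S i ≡ true → lookup S j ≡ true → i ≢ j → color c i j ≢ d

misses⇒two : ∀ {n} (c : Coloring n) d S → Misses c d S → AtMostTwoColors c S
misses⇒two c d S miss = let s , t , other = others d in s , t , λ i j i∈ j∈ i≢j →
  other (color c i j) (miss i j ([]=⇒lookup i∈) ([]=⇒lookup j∈) i≢j)
  where
  others : ∀ d → ∃ λ s → ∃ λ t → ∀ e → e ≢ d → e ≡ s ⊎ e ≡ t
  others r = b , y , λ { r ≢ → contradiction refl ≢ ; b _ → inj₁ refl ; y _ → inj₂ refl }
  others b = r , y , λ { b ≢ → contradiction refl ≢ ; r _ → inj₁ refl ; y _ → inj₂ refl }
  others y = r , b , λ { y ≢ → contradiction refl ≢ ; r _ → inj₁ refl ; b _ → inj₂ refl }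

two⇒misses : ∀ {n} (c : Coloring n) S → AtMostTwoColors c S → ∃ λ d → Misses c d S
two⇒misses c S (s , t , two) = let d , d≢s , d≢t = third s t in d , λ i j Si Sj i≢j ij≡d →
  [ (λ eq → d≢s (trans (sym ij≡d) eq)) , (λ eq → d≢t (trans (sym ij≡d) eq)) ]′
    (two i j (lookup⇒[]= i S Si) (lookup⇒[]= j S Sj) i≢j)
  where
  third : ∀ s t → ∃ λ d → d ≢ s × d ≢ t
  third r r = b , (λ ()) , λ ()
  third r b = y , (λ ()) , λ ()
  third r y = b , (λ ()) , λ ()
  third b r = y , (λ ()) , λ ()
  third b b = r , (λ ()) , λ ()
  third b y = r , (λ ()) , λ ()
  third y r = b , (λ ()) , λ ()
  third y b = r , (λ ()) , λ ()
  third y y = r , (λ ()) , λ ()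

-- Without yellow, red is a matching on S.  Both the set of vertices with a
-- smaller red neighbour in S and its complement in S then contain no red edge.
yellow-free≤ : ∀ {n} (c : Coloring n) → Cherries c → ∀ k → (∀ S → Misses c r S → size S ≤ k) →
               ∀ S → Misses c y S → size S ≤ k + k
yellow-free≤ {n} c cherries k red-free S no-yellow = begin
  size S                                       ≤⟨ ∑-mono (allFin n) covered ⟩
  ∑ᶠ (λ i → ⟦ lookup upper i ⟧ + ⟦ lookup lower i ⟧)  ≡⟨ ∑-+ (allFin n) _ _ ⟩
  size upper + size lower
    ≤⟨ +-mono-≤ (red-free upper upper-red-free) (red-free lower lower-red-free) ⟩
  k + k                                        ∎
  where
  open ≤-Reasoning
  HasLower : Fin n → Set
  HasLower i = ∃ λ j → lookup S j ≡ true × j Fin.< i × color c j i ≡ r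
  hasLower? : ∀ i → Dec (HasLower i)
  hasLower? i = Fin.any? λ j → (lookup S j Bool.≟ true) ×-dec (j Fin.<? i) ×-dec isRed? (color c j i)
  upper? : ∀ i → Dec (lookup S i ≡ true × HasLower i)
  upper? i = (lookup S i Bool.≟ true) ×-dec hasLower? i
  lower? : ∀ i → Dec (lookup S i ≡ true × ¬ HasLower i)
  lower? i = (lookup S i Bool.≟ true) ×-dec ¬? (hasLower? i)
  upper lower : Subset n
  upper = Vec.tabulate λ i → does (upper? i)
  lower = Vec.tabulate λ i → does (lower? i)
  in-upper : ∀ i → lookup upper i ≡ true → lookup S i ≡ true × HasLower i
  in-upper i eq = does⇒ (upper? i) (trans (sym (lookup∘tabulate (λ i → does (upper? i)) i)) eq)
  in-lower : ∀ i → lookup lower i ≡ true → lookup S i ≡ true × ¬ HasLower i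
  in-lower i eq = does⇒ (lower? i) (trans (sym (lookup∘tabulate (λ i → does (lower? i)) i)) eq)
  covered : ∀ i → ⟦ lookup S i ⟧ ≤ ⟦ lookup upper i ⟧ + ⟦ lookup lower i ⟧
  covered i rewrite lookup∘tabulate (λ i → does (upper? i)) i | lookup∘tabulate (λ i → does (lower? i)) i
    with lookup S i | hasLower? i
  ... | false | _ = z≤n
  ... | true | yes _ = s≤s z≤n
  ... | true | no _ = s≤s z≤n
  no-red : ∀ {P : Fin n → Set} → (∀ i j → P i → P j → i Fin.< j → color c i j ≢ r) →
           ∀ i j → P i → P j → i ≢ j → color c i j ≢ r
  no-red h i j Pi Pj i≢j ij with Fin.<-cmp i j
  ... | tri< i<j _ _ = h i j Pi Pj i<j ij
  ... | tri≈ _ i≡j _ = i≢j i≡j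
  ... | tri> _ _ j<i = h j i Pj Pi j<i (trans (color-sym c j i) ij)
  lower-red-free : Misses c r lower
  lower-red-free = no-red λ i j Li Lj i<j ij → proj₂ (in-lower j Lj) (i , proj₁ (in-lower i Li) , i<j , ij)
  upper-red-free : Misses c r upper
  upper-red-free = no-red λ i j Ui Uj i<j ij →
    let Si , h , Sh , h<i , hi = in-upper i Ui
        Sj = proj₁ (in-upper j Uj)
        h≢j = Fin.<⇒≢ (Fin.<-trans h<i i<j)
    in no-yellow h j Sh Sj h≢j (cherries h i j (Fin.<⇒≢ h<i) (Fin.<⇒≢ i<j) h≢j hi ij)

-- The coloring of a typical matrix

module FromTypical {n k T D M : ℕ} {x : Matrix n} (typical : Typical k T D M x) where

  open FromMatrix x

  -- Red takes precedence over yellow: a red pair may have a common neighbour, only not one smaller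
  -- than both ends.
  chooseColor : ∀ {P Q : Set} → Dec P → Dec Q → Color
  chooseColor (yes _) _ = r
  chooseColor (no _) (yes _) = y
  chooseColor (no _) (no _) = b

  chooseColor-r : ∀ {P Q : Set} (P? : Dec P) (Q? : Dec Q) → P → chooseColor P? Q? ≡ r
  chooseColor-r (yes _) _ _ = refl
  chooseColor-r (no ¬p) _ p = contradiction p ¬p

  chooseColor-y : ∀ {P Q : Set} (P? : Dec P) (Q? : Dec Q) → ¬ P → Q → chooseColor P? Q? ≡ y
  chooseColor-y (yes p) _ ¬p _ = contradiction p ¬p
  chooseColor-y (no _) (yes _) _ _ = refl
  chooseColor-y (no _) (no ¬q) _ q = contradiction q ¬q

  chooseColor⇒ : ∀ {P Q : Set} (P? : Dec P) (Q? : Dec Q) →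
    (chooseColor P? Q? ≡ r → P) × (chooseColor P? Q? ≢ b → P ⊎ Q)
  chooseColor⇒ (yes p) _ = (λ _ → p) , λ _ → inj₁ p
  chooseColor⇒ (no _) (yes q) = (λ ()) , λ _ → inj₂ q
  chooseColor⇒ (no _) (no _) = (λ ()) , λ ≢b → contradiction refl ≢b

  chooseColor-cong : ∀ {P Q P′ Q′ : Set} (P? : Dec P) (Q? : Dec Q) (P′? : Dec P′) (Q′? : Dec Q′) →
    (P → P′) → (P′ → P) → (Q → Q′) → (Q′ → Q) → chooseColor P? Q? ≡ chooseColor P′? Q′?
  chooseColor-cong (yes _) _ (yes _) _ _ _ _ _ = refl
  chooseColor-cong (yes p) _ (no ¬p) _ f _ _ _ = contradiction (f p) ¬p
  chooseColor-cong (no ¬p) _ (yes p) _ _ g _ _ = contradiction (g p) ¬p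
  chooseColor-cong (no _) (yes _) (no _) (yes _) _ _ _ _ = refl
  chooseColor-cong (no _) (yes q) (no _) (no ¬q) _ _ f _ = contradiction (f q) ¬q
  chooseColor-cong (no _) (no ¬q) (no _) (yes q) _ _ _ g = contradiction (g q) ¬q
  chooseColor-cong (no _) (no _) (no _) (no _) _ _ _ _ = refl

  typicalColoring : Coloring n
  typicalColoring = coloring (λ i j → chooseColor (Red? i j) (Common? i j)) λ i j →
    chooseColor-cong (Red? i j) (Common? i j) (Red? j i) (Common? j i) Red-sym Red-sym Common-sym Common-sym

  private
    c = typicalColoring

    red⇒ : ∀ {i j} → color c i j ≡ r → Red i j
    red⇒ {i} {j} = proj₁ (chooseColor⇒ (Red? i j) (Common? i j))

  -- The ends of a red path are not joined by red, as red is triangle-free, and its middle vertex is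
  -- a common neighbour of them.
  typicalColoring-cherries : Cherries c
  typicalColoring-cherries i j k _ _ _ ij jk = chooseColor-y (Red? i k) (Common? i k)
    (Red-triangle-free (red⇒ ij) (red⇒ jk))
    (j , Edge-sym (proj₁ (red⇒ ij)) , proj₁ (red⇒ jk))

  -- Missing a color passes to subsets, so a larger set could be cut down to exactly k vertices.
  shrink : ∀ d → (k ≤ n → ∀ S → size S ≡ k → ¬ Misses c d S) → ∀ S → Misses c d S → size S ≤ k
  shrink d none S miss with k ≤? size S
  ... | no k≰ = <⇒≤ (≰⇒> k≰)
  ... | yes k≤ = contradiction (λ i j S′i S′j → miss i j (S′⊑S i S′i) (S′⊑S j S′j)) (none (≤-trans k≤ size≤n) S′ S′≡k)
    where
    size≤n : size S ≤ n
    size≤n = ≤-trans (size-mono {P = S} {Vec.replicate n true} λ i _ → lookup-replicate i true) (≤-reflexive (size-⊤ n))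
    sub = interpolate (Vec.replicate n false) S k (⊥⊑ S) (≤-trans (≤-reflexive (size-⊥ n)) z≤n) k≤
    S′ = proj₁ sub
    S′⊑S = proj₁ (proj₂ (proj₂ sub))
    S′≡k = proj₂ (proj₂ (proj₂ sub))

  module _ (room₁ : k + 2 * M + cherryBound typical ≤ k * k)
           (room₂ : k + 2 * (k * T) + cherryBound typical ≤ k * k) where

    private
      red-free≤ : ∀ S → Misses c r S → size S ≤ k
      red-free≤ = shrink r λ k≤n S S≡k miss → red-free-small typical k≤n room₁ S S≡k
        λ i j Si Sj red → miss i j Si Sj (Edge⇒≢ (proj₁ red)) (chooseColor-r (Red? i j) (Common? i j) red)

      blue-free≤ : ∀ S → Misses c b S → size S ≤ k
      blue-free≤ = shrink b λ k≤n S S≡k miss → blue-free-small typical k≤n room₂ S S≡k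
        λ i j Si Sj i≢j → proj₂ (chooseColor⇒ (Red? i j) (Common? i j)) (miss i j Si Sj i≢j)

    typicalColoring-two : ∀ S → AtMostTwoColors c S → size S ≤ k + k
    typicalColoring-two S two with two⇒misses c S two
    ... | r , miss = ≤-trans (red-free≤ S miss) (m≤m+n k k)
    ... | b , miss = ≤-trans (blue-free≤ S miss) (m≤m+n k k)
    ... | y , miss = yellow-free≤ c typicalColoring-cherries k red-free≤ S miss

open FromTypical using (typicalColoring; typicalColoring-cherries; typicalColoring-two)

two≤h₂ᶜ : ∀ {n} (c : Coloring n) S → AtMostTwoColors c S → size S ≤ h₂ᶜ c
two≤h₂ᶜ c S two = proj₂ (proj₂ (∃h₂ᶜ c)) (size S) (S , ∣∣≡size S , two)

h₂ᶜ≤ : ∀ {n} (c : Coloring n) K → (∀ S → AtMostTwoColors c S → size S ≤ K) → h₂ᶜ c ≤ K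
h₂ᶜ≤ c K bound = let S , S≡ , two = proj₁ (proj₂ (∃h₂ᶜ c)) in
  ≤-trans (≤-reflexive (trans (sym S≡) (∣∣≡size S))) (bound S two)

-- Bounds for given n and the choice of parameters

bracket : ∀ (f : ℕ → ℕ) {n} N → f 0 < n → n ≤ f N → ∃ λ l → f l < n × n ≤ f (suc l)
bracket f zero f0< n≤ = contradiction n≤ (<⇒≱ f0<)
bracket f {n} (suc N) f0< n≤ with n ≤? f N
... | yes n≤N = bracket f N f0< n≤N
... | no n≰N = N , ≰⇒> n≰N , n≤

quadratic-bound : ∀ {n h} → (∀ D ℓ → 4 ^ ℓ + ℓ ≤ D → n * ℓ ≤ (D + h) * h) →
                  2 ^ 9 < n → ∃ λ L → n ≤ 2 ^ L × n * L ≤ 6 * h * (6 * h)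
-- For D = 2^(3ℓ + 1) this places n between 2D² and 64 times that. The shift to ℓ = suc ℓ₀ gives ℓ ≥
-- 1, as 6ℓ + 9 ≤ 15ℓ demands.
quadratic-bound {n} {h} bound n> with bracket (λ ℓ → 2 ^ (6 * suc ℓ + 3)) n n>
  (≤-trans (<⇒≤ (t<2^t n)) (^-monoʳ-≤ 2 (≤-trans (n≤1+n n) (≤-trans (m≤m+n (suc n) (5 * suc n)) (m≤m+n _ 3)))))
... | ℓ₀ , <n , n≤ = 6 * suc ℓ + 3 , n≤ , (begin
  n * (6 * suc ℓ + 3)
    ≤⟨ *-monoʳ-≤ n (≤-trans (≤-reflexive (lemma₁ ℓ)) (≤-trans (+-monoʳ-≤ (6 * ℓ) (*-monoʳ-≤ 9 (s≤s z≤n))) (≤-reflexive (lemma₂ ℓ)))) ⟩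
  n * (15 * ℓ)             ≡⟨ lemma₃ n ℓ ⟩
  15 * (n * ℓ)             ≤⟨ *-monoʳ-≤ 15 nℓ≤ ⟩
  15 * ((h + h) * h)       ≡⟨ lemma₄ h ⟩
  -- Rounding 30 up to the square 36 lets the root be taken; this is where the constant 1/6 comes
  -- from.
  30 * (h * h)             ≤⟨ *-monoˡ-≤ (h * h) (≤ᵇ⇒≤ 30 36 tt) ⟩
  36 * (h * h)             ≡⟨ lemma₅ h ⟩
  6 * h * (6 * h)          ∎)
  where
  open ≤-Reasoning
  ℓ = suc ℓ₀
  D = 2 ^ (3 * ℓ + 1)
  lemma₁ : ∀ ℓ → 6 * (1 + ℓ) + 3 ≡ 6 * ℓ + 9 * 1
  lemma₁ = solve-∀
  lemma₂ : ∀ ℓ → 6 * ℓ + 9 * ℓ ≡ 15 * ℓ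
  lemma₂ = solve-∀
  lemma₃ : ∀ n ℓ → n * (15 * ℓ) ≡ 15 * (n * ℓ)
  lemma₃ = solve-∀
  lemma₄ : ∀ h → 15 * ((h + h) * h) ≡ 30 * (h * h)
  lemma₄ = solve-∀
  lemma₅ : ∀ h → 36 * (h * h) ≡ 6 * h * (6 * h)
  lemma₅ = solve-∀
  large : 4 ^ ℓ + ℓ ≤ D
  large = begin
    4 ^ ℓ + ℓ                      ≡⟨ cong (_+ ℓ) (^-*-assoc 2 2 ℓ) ⟩
    2 ^ (2 * ℓ) + ℓ
      ≤⟨ +-mono-≤ (^-monoʳ-≤ 2 (*-monoˡ-≤ ℓ (≤ᵇ⇒≤ 2 3 tt))) (≤-trans (<⇒≤ (t<2^t ℓ)) (^-monoʳ-≤ 2 (m≤m+n ℓ _))) ⟩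
    2 ^ (3 * ℓ) + 2 ^ (3 * ℓ)      ≡⟨ lemma (2 ^ (3 * ℓ)) ⟩
    2 ^ (3 * ℓ) * 2 ^ 1            ≡⟨ ^-distribˡ-+-* 2 (3 * ℓ) 1 ⟨
    D                              ∎
    where
    lemma : ∀ a → a + a ≡ a * 2
    lemma = solve-∀
  D<h : D < h
  D<h = ≰⇒> λ h≤D → contradiction <n (≤⇒≯ (begin
    n                              ≤⟨ m≤m*n n ℓ ⟩
    n * ℓ                          ≤⟨ bound D ℓ large ⟩
    (D + h) * h                    ≤⟨ *-mono-≤ (+-monoʳ-≤ D h≤D) h≤D ⟩
    (D + D) * D                    ≡⟨ lemma D ⟩
    2 * (D * D)                    ≡⟨ cong (2 *_) (^-distribˡ-+-* 2 (3 * ℓ + 1) (3 * ℓ + 1)) ⟨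
    2 ^ (1 + (3 * ℓ + 1 + (3 * ℓ + 1))) ≡⟨ cong (2 ^_) (lemma′ ℓ) ⟩
    2 ^ (6 * ℓ + 3)                ∎))
    where
    lemma : ∀ a → (a + a) * a ≡ 2 * (a * a)
    lemma = solve-∀
    lemma′ : ∀ ℓ → 1 + (3 * ℓ + 1 + (3 * ℓ + 1)) ≡ 6 * ℓ + 3
    lemma′ = solve-∀
  nℓ≤ : n * ℓ ≤ (h + h) * h
  nℓ≤ = bound h ℓ (≤-trans large (<⇒≤ D<h))

module Lower {n : ℕ} (c : Coloring n) (c∈Forb : Forb n rrr,rrb c) where

  private
    h = h₂ᶜ c

    RedEdge : Fin n → Fin n → Set
    RedEdge i j = i ≢ j × color c i j ≡ r

    RedEdge? : ∀ i j → Dec (RedEdge i j)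
    RedEdge? i j = ¬? (i Fin.≟ j) ×-dec isRed? (color c i j)

    cherry : ∀ {i j k} → RedEdge i j → RedEdge i k → j ≢ k → color c j k ≡ y
    cherry {i} {j} {k} (i≢j , ij) (i≢k , ik) j≢k =
      Forb⇒Cherries c c∈Forb j i k (i≢j ∘ sym) i≢k j≢k (trans (color-sym c j i) ij) ik

    open TriangleFree RedEdge RedEdge? (λ (i≢j , ij) → i≢j ∘ sym , trans (color-sym c _ _) ij)
      (λ (i≢i , _) → i≢i refl)
      (λ ij ik (j≢k , jk) → contradiction (trans (sym jk) (cherry ij ik j≢k)) λ ())

    degree≤h : ∀ v → degree v ≤ h
    degree≤h v = ≤-trans (≤-reflexive (∑-cong (allFin n) λ u → cong ⟦_⟧ (sym (lookup∘tabulate (λ u → does (RedEdge? v u)) u))))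
      (two≤h₂ᶜ c N (misses⇒two c r N λ i j Ni Nj i≢j ij → contradiction (trans (sym ij) (cherry (edge i Ni) (edge j Nj) i≢j)) λ ()))
      where
      N : Subset n
      N = Vec.tabulate λ u → does (RedEdge? v u)
      edge : ∀ i → lookup N i ≡ true → RedEdge v i
      edge i Ni = does⇒ (RedEdge? v i) (trans (sym (lookup∘tabulate _ i)) Ni)

    independent≤h : ∀ W → Independent W → size W ≤ h
    independent≤h W ind = two≤h₂ᶜ c W (misses⇒two c r W λ i j Wi Wj i≢j ij → ind i j Wi Wj (i≢j , ij))

  h₂ᶜ-bound : ∀ D ℓ → 4 ^ ℓ + ℓ ≤ D → n * ℓ ≤ (D + h) * h
  h₂ᶜ-bound D ℓ large = independence-bound D ℓ large h degree≤h independent≤h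

-- With m = e s and k = 4 e s l, all terms are multiples of (s l)²; e is only
-- required to be large.
room : ∀ e s l n D → 1 ≤ s → 1 ≤ l → 101 ≤ e → n ≤ e * s * s → 2 * D ≤ 5 * s →
       let k = e * s * (4 * l); cherries = n * (2 * (10 * l) * (2 * (10 * l))) + 2 * D * (2 * (k * (10 * l))) in
       k + 2 * (e * s * (k * l)) + cherries ≤ k * k × k + 2 * (k * (10 * l)) + cherries ≤ k * k
room e s l n D 1≤s 1≤l 101≤e n≤ D≤ = total (8 * e) ≤-refl testing ,
  total 80 (≤-trans (≤ᵇ⇒≤ 80 (8 * 101) tt) (*-monoʳ-≤ 8 101≤e)) spanning
  where
  open ≤-Reasoning
  k = e * s * (4 * l)
  X = s * l * (s * l)
  cherries = n * (2 * (10 * l) * (2 * (10 * l))) + 2 * D * (2 * (k * (10 * l)))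
  k≤ : k ≤ e * 4 * X
  k≤ = ≤-trans (≤-reflexive (lemma e s l)) (*-monoʳ-≤ (e * 4) (m≤m*n (s * l) (s * l) {{>-nonZero (*-mono-≤ 1≤s 1≤l)}}))
    where
    lemma : ∀ e s l → e * s * (4 * l) ≡ e * 4 * (s * l)
    lemma = solve-∀
  cherries≤X : cherries ≤ e * 800 * X
  cherries≤X = begin
    cherries
      ≤⟨ +-mono-≤ (*-monoˡ-≤ (2 * (10 * l) * (2 * (10 * l))) n≤) (*-monoˡ-≤ (2 * (k * (10 * l))) D≤) ⟩
    e * s * s * (2 * (10 * l) * (2 * (10 * l))) + 5 * s * (2 * (k * (10 * l)))
      ≡⟨ lemma e s l ⟩
    e * 800 * X ∎
    where
    lemma : ∀ e s l → e * s * s * (2 * (10 * l) * (2 * (10 * l))) + 5 * s * (2 * (e * s * (4 * l) * (10 * l)))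
            ≡ e * 800 * (s * l * (s * l))
    lemma = solve-∀
  testing : 2 * (e * s * (k * l)) ≤ e * (8 * e) * X
  testing = ≤-reflexive (lemma e s l)
    where
    lemma : ∀ e s l → 2 * (e * s * (e * s * (4 * l) * l)) ≡ e * (8 * e) * (s * l * (s * l))
    lemma = solve-∀
  spanning : 2 * (k * (10 * l)) ≤ e * 80 * X
  spanning = begin
    2 * (k * (10 * l))        ≡⟨ lemma e s l ⟩
    e * 80 * (s * l * l)
      ≤⟨ *-monoʳ-≤ (e * 80) (≤-trans (m≤m*n (s * l * l) s {{>-nonZero 1≤s}}) (≤-reflexive (lemma′ s l))) ⟩
    e * 80 * X                ∎
    where
    lemma : ∀ e s l → 2 * (e * s * (4 * l) * (10 * l)) ≡ e * 80 * (s * l * l)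
    lemma = solve-∀
    lemma′ : ∀ s l → s * l * l * s ≡ s * l * (s * l)
    lemma′ = solve-∀
  -- k * k is 16 e² X. The terms k and `cherries` take 804 e X, below half of it once 8 e ≥ 804,
  -- whence 101; t fits into the other half.
  total : ∀ a {t} → a ≤ 8 * e → t ≤ e * a * X → k + t + cherries ≤ k * k
  total a {t} a≤ t≤ = begin
    k + t + cherries                            ≤⟨ +-mono-≤ (+-mono-≤ k≤ t≤) cherries≤X ⟩
    e * 4 * X + e * a * X + e * 800 * X         ≡⟨ lemma e a X ⟩
    e * (804 + a) * X
      ≤⟨ *-monoˡ-≤ X (*-monoʳ-≤ e (+-mono-≤ (≤-trans (≤ᵇ⇒≤ 804 (8 * 101) tt) (*-monoʳ-≤ 8 101≤e)) a≤)) ⟩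
    e * (8 * e + 8 * e) * X                     ≡⟨ lemma′ e s l ⟩
    k * k                                       ∎
    where
    lemma : ∀ e a X → e * 4 * X + e * a * X + e * 800 * X ≡ e * (804 + a) * X
    lemma = solve-∀
    lemma′ : ∀ e s l → e * (8 * e + 8 * e) * (s * l * (s * l)) ≡ e * s * (4 * l) * (e * s * (4 * l))
    lemma′ = solve-∀

typical⇒h₂ᶜ≤ : ∀ {n k T D M} {x : Matrix n} (typical : Typical k T D M x) →
  k + 2 * M + cherryBound typical ≤ k * k → k + 2 * (k * T) + cherryBound typical ≤ k * k →
  ∃ λ c → Forb n rrr,rrb c × h₂ᶜ c ≤ 2 * k
typical⇒h₂ᶜ≤ {k = k} typical room₁ room₂ =
  typicalColoring typical , Cherries⇒Forb (typicalColoring typical) (typicalColoring-cherries typical) ,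
  h₂ᶜ≤ (typicalColoring typical) (2 * k) λ S two → ≤-trans (typicalColoring-two typical room₁ room₂ S two)
    (≤-reflexive (cong (k +_) (sym (+-identityʳ k))))

-- The factor 2 * 64 exceeds the 101 that `room` demands and keeps m = 2 (64 s) even, as the bound
-- (1 + 1/m)^m ≤ 4 requires.
upper-coloring : ∀ n s L → 1 ≤ s → n ≤ 2 * 64 * s * s → n ≤ 2 ^ L → 2 * (2 * s + (L + 3)) ≤ 5 * s →
                 ∃ λ c → Forb n rrr,rrb c × h₂ᶜ c ≤ 2 * (2 * 64 * s * (4 * suc L))
upper-coloring n s L 1≤s n≤ n≤2^L D≤ = coloring′ (2 * 64 * s) refl
  where
  D = 2 * s + (L + 3)
  coloring′ : ∀ m → m ≡ 2 * 64 * s → ∃ λ c → Forb n rrr,rrb c × h₂ᶜ c ≤ 2 * (m * (4 * suc L))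
  coloring′ (suc zero) eq = contradiction eq (<⇒≢ (≤-trans (≤ᵇ⇒≤ 2 (2 * 64 * 1) tt) (*-monoʳ-≤ (2 * 64) 1≤s)))
  coloring′ zero eq = contradiction eq (<⇒≢ (≤-trans (≤ᵇ⇒≤ 1 (2 * 64 * 1) tt) (*-monoʳ-≤ (2 * 64) 1≤s)))
  coloring′ m@(suc q@(suc _)) eq = typical⇒h₂ᶜ≤ (proj₂ found) (proj₁ rooms) (proj₂ rooms)
    where
    k = m * (4 * suc L)
    found : ∃ (Typical k (10 * suc L) D (m * (k * suc L)))
    found = Existence.typical q (64 * s) n s L (trans eq (*-assoc 2 64 s)) (subst (λ m → n ≤ m * s) (sym eq) n≤)
      n≤2^L k (≤-trans (≤ᵇ⇒≤ 3 (2 * 4) tt) (*-mono-≤ {2} {m} {4} {4 * suc L} (s≤s (s≤s z≤n)) (m≤m*n 4 (suc L)))) refl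
    rooms = subst (λ m → let k = m * (4 * suc L)
                             cherries = n * (2 * (10 * suc L) * (2 * (10 * suc L))) + 2 * D * (2 * (k * (10 * suc L))) in
       k + 2 * (m * (k * suc L)) + cherries ≤ k * k × k + 2 * (k * (10 * suc L)) + cherries ≤ k * k) (sym eq)
      (room (2 * 64) s (suc L) n D 1≤s (s≤s z≤n) (≤ᵇ⇒≤ 101 (2 * 64) tt) n≤ D≤)

-- The exponential dominates from exponent 10 on, where 28² = 784 ≤ 1024. This forces √n, and with
-- it s, above the logarithmic term in D.
[2l+8]²≤2^l : ∀ l → (2 * (10 + l) + 8) * (2 * (10 + l) + 8) ≤ 2 ^ (10 + l)
[2l+8]²≤2^l zero = ≤ᵇ⇒≤ (28 * 28) (2 ^ 10) tt
[2l+8]²≤2^l (suc l) = begin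
  (2 * (10 + suc l) + 8) * (2 * (10 + suc l) + 8)   ≡⟨ lemma l ⟩
  (l * l * 4 + l * 120 + 900)                       ≤⟨ m≤m+n _ (l * l * 4 + l * 104 + 668) ⟩
  (l * l * 4 + l * 120 + 900) + (l * l * 4 + l * 104 + 668) ≡⟨ lemma′ l ⟩
  2 * ((2 * (10 + l) + 8) * (2 * (10 + l) + 8))     ≤⟨ *-monoʳ-≤ 2 ([2l+8]²≤2^l l) ⟩
  2 ^ (10 + suc l)                                  ∎
  where
  open ≤-Reasoning
  lemma : ∀ l → (2 * (10 + (1 + l)) + 8) * (2 * (10 + (1 + l)) + 8) ≡ l * l * 4 + l * 120 + 900
  lemma = solve-∀
  lemma′ : ∀ l → (l * l * 4 + l * 120 + 900) + (l * l * 4 + l * 104 + 668) ≡ 2 * ((2 * (10 + l) + 8) * (2 * (10 + l) + 8))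
  lemma′ = solve-∀

-- The lower inequalities are strict so that s and `suc l` belong to the lower cuts of √n and log₂
-- n. The last condition amounts to 2 (L + 3) ≤ s for L = 2 + l.
upper-brackets : ∀ n → 2 ^ 10 < n → ∃ λ s → ∃ λ l → s * s < n × 2 ^ suc l < n ×
  1 ≤ s × n ≤ 2 * 64 * s * s × n ≤ 2 ^ (2 + l) × 2 * (2 * s + ((2 + l) + 3)) ≤ 5 * s
upper-brackets n n> with bracket (λ s → s * s) n (≤-trans (s≤s z≤n) n>) (m≤m*n n n {{>-nonZero (≤-trans (s≤s z≤n) n>)}})
   | bracket (λ l → 2 ^ suc l) n (≤-trans (s≤s (≤ᵇ⇒≤ 2 (2 ^ 10) tt)) n>) (≤-trans (<⇒≤ (t<2^t n)) (^-monoʳ-≤ 2 (n≤1+n n)))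
... | s , s² , n≤s² | l , 2^l , n≤2^ = s , l , s² , 2^l , 1≤s , n≤128s² , n≤2^ , D≤
  where
  open ≤-Reasoning
  10≤1+l : 10 ≤ suc l
  10≤1+l = ≮⇒≥ λ l<10 → contradiction n> (≤⇒≯ (≤-trans n≤2^ (^-monoʳ-≤ 2 l<10)))
  2l+10≤s : 2 * suc l + 8 ≤ s
  2l+10≤s = ≮⇒≥ λ s< → contradiction 2^l (≤⇒≯ (begin
    n                                        ≤⟨ n≤s² ⟩
    suc s * suc s                            ≤⟨ *-mono-≤ s< s< ⟩
    (2 * suc l + 8) * (2 * suc l + 8)
      ≤⟨ subst (λ l → (2 * l + 8) * (2 * l + 8) ≤ 2 ^ l) (m+[n∸m]≡n 10≤1+l) ([2l+8]²≤2^l (suc l ∸ 10)) ⟩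
    2 ^ suc l                                ∎))
  1≤s : 1 ≤ s
  1≤s = ≤-trans (≤-trans (s≤s z≤n) (m≤n+m 8 (2 * suc l))) 2l+10≤s
  n≤128s² : n ≤ 2 * 64 * s * s
  n≤128s² = begin
    n                     ≤⟨ n≤s² ⟩
    suc s * suc s         ≤⟨ *-mono-≤ (+-monoˡ-≤ s 1≤s) (+-monoˡ-≤ s 1≤s) ⟩
    (s + s) * (s + s)     ≡⟨ lemma s ⟩
    4 * (s * s)           ≤⟨ *-monoˡ-≤ (s * s) (≤ᵇ⇒≤ 4 (2 * 64) tt) ⟩
    2 * 64 * (s * s)      ≡⟨ *-assoc (2 * 64) s s ⟨
    2 * 64 * s * s        ∎
    where
    lemma : ∀ s → (s + s) * (s + s) ≡ 4 * (s * s)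
    lemma = solve-∀
  D≤ : 2 * (2 * s + ((2 + l) + 3)) ≤ 5 * s
  D≤ = begin
    2 * (2 * s + ((2 + l) + 3))       ≡⟨ lemma s l ⟩
    4 * s + (2 * suc l + 8)     ≤⟨ +-monoʳ-≤ (4 * s) 2l+10≤s ⟩
    4 * s + s                   ≡⟨ lemma′ s ⟩
    5 * s                       ∎
    where
    lemma : ∀ s l → 2 * (2 * s + ((2 + l) + 3)) ≡ 4 * s + (2 * (1 + l) + 8)
    lemma = solve-∀
    lemma′ : ∀ s → 4 * s + s ≡ 5 * s
    lemma′ = solve-∀

h₂ᶜ-upper : ∀ n → 2 ^ 10 < n → ∃ λ s → ∃ λ l → s * s < n × 2 ^ suc l < n ×
            ∃ λ c → Forb n rrr,rrb c × h₂ᶜ c ≤ 2 * 64 * 24 * (s * suc l)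
h₂ᶜ-upper n n> =
  let s , l , s²<n , 2^l<n , 1≤s , n≤s² , n≤2^l , D≤ = upper-brackets n n>
      c , c∈Forb , h≤ = upper-coloring n s (2 + l) 1≤s n≤s² n≤2^l D≤
  in s , l , s²<n , 2^l<n , c , c∈Forb , ≤-trans h≤ (bound s l)
  where
  open ≤-Reasoning
  bound : ∀ s l → 2 * (2 * 64 * s * (4 * (3 + l))) ≤ 2 * 64 * 24 * (s * suc l)
  bound s l = begin
    2 * (2 * 64 * s * (4 * (3 + l)))     ≡⟨ lemma₁ s l ⟩
    2 * 64 * 8 * (s * (3 + l))           ≤⟨ *-monoʳ-≤ (2 * 64 * 8) (*-monoʳ-≤ s (+-monoʳ-≤ 3 (m≤n*m l 3))) ⟩
    2 * 64 * 8 * (s * (3 + 3 * l))       ≡⟨ lemma₂ s l ⟩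
    2 * 64 * 24 * (s * suc l)            ∎
    where
    lemma₁ : ∀ s l → 2 * (2 * 64 * s * (4 * (3 + l))) ≡ 2 * 64 * 8 * (s * (3 + l))
    lemma₁ = solve-∀
    lemma₂ : ∀ s l → 2 * 64 * 8 * (s * (3 + 3 * l)) ≡ 2 * 64 * 24 * (s * (1 + l))
    lemma₂ = solve-∀

-- Asymptotics

private
  ⌜_⌝ : ℕ → ℚᵘ
  ⌜ n ⌝ = mkℚᵘ (ℤ.+ n) 0

  ⌜⌝-mono-≤ : ∀ {a c} → a ≤ c → ⌜ a ⌝ ℚᵘ.≤ ⌜ c ⌝
  ⌜⌝-mono-≤ a≤c = *≤* (ℤ.*-monoʳ-≤-nonNeg (ℤ.+ 1) (ℤ.+≤+ a≤c))

  ⌜⌝-mono-< : ∀ {a c} → a < c → ⌜ a ⌝ ℚᵘ.< ⌜ c ⌝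
  ⌜⌝-mono-< a<c = *<* (ℤ.*-monoʳ-<-pos (ℤ.+ 1) (ℤ.+<+ a<c))

  ⌜⌝-* : ∀ a c → ⌜ a ⌝ ℚᵘ.* ⌜ c ⌝ ≡ ⌜ a * c ⌝
  ⌜⌝-* a c = cong (λ z → mkℚᵘ z 0) (sym (ℤ.pos-* a c))

  log₂<⇒ : ∀ {n L} → n ≤ 2 ^ L → ∀ q → log₂ n q → q ℚᵘ.< ⌜ L ⌝
  log₂<⇒ {n} {L} n≤ q@(mkℚᵘ (ℤ.+ p) d-1) (_ , 2^p<n^d) =
    *<* (subst₂ ℤ._<_ (sym (ℤ.*-identityʳ (ℤ.+ p))) (ℤ.pos-* L (suc d-1)) (ℤ.+<+ p<Ld))
    where
    p<Ld : p < L * suc d-1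
    p<Ld = ≰⇒> λ Ld≤p → contradiction 2^p<n^d (≤⇒≯ (≤-trans (^-monoˡ-≤ (suc d-1) n≤)
      (≤-trans (≤-reflexive (^-*-assoc 2 L (suc d-1))) (^-monoʳ-≤ 2 Ld≤p))))
  log₂<⇒ _ (mkℚᵘ (ℤ.-[1+ _ ]) _) (() , _)

-- Log n suffices in place of its power 3/2: the cut of the latter contains
-- t = suc l, as t² ≤ t³.
≼-upper : ∀ K s l {n H} → s * s < n → 2 ^ suc l < n → H ≤ K * (s * suc l) →
          fromℕ H ≼ fromℚ (mkℚᵘ (ℤ.+ suc K) 0) · (√ (fromℕ n) · (log₂ n ^3/2))
≼-upper K s l {n} {H} s²<n 2^l<n H≤ q (q≥0 , q<H) =
  -- Cuts are open: K is an element of the cut of `suc K`, not of its own.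
  q≥0 , ⌜ K ⌝ , ⌜ s * suc l ⌝ , (_ , ⌜⌝-mono-< ≤-refl) ,
  (_ , ⌜ s ⌝ , ⌜ suc l ⌝ ,
    (_ , nonNeg s s , subst (ℚᵘ._< ⌜ n ⌝) (sym (⌜⌝-* s s)) (⌜⌝-mono-< s²<n)) ,
    (_ , nonNeg (suc l) (suc l) , ⌜ suc l * suc l ⌝ , ⌜ suc l ⌝ ,
      (_ , ⌜ suc l ⌝ , ⌜ suc l ⌝ , log , log , ℚᵘ.≤-reflexive (ℚᵘ.≃-reflexive (sym (⌜⌝-* (suc l) (suc l))))) , log ,
      subst₂ ℚᵘ._≤_ (sym (⌜⌝-* (suc l) (suc l))) (sym (⌜⌝-* (suc l * suc l) (suc l)))
        (⌜⌝-mono-≤ (m≤m*n (suc l * suc l) (suc l)))) ,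
    ℚᵘ.≤-reflexive (ℚᵘ.≃-reflexive (sym (⌜⌝-* s (suc l))))) ,
  ℚᵘ.≤-trans (ℚᵘ.<⇒≤ q<H) (subst (⌜ H ⌝ ℚᵘ.≤_) (sym (⌜⌝-* K (s * suc l))) (⌜⌝-mono-≤ H≤))
  where
  nonNeg : ∀ a c → NonNegative (⌜ a ⌝ ℚᵘ.* ⌜ c ⌝)
  nonNeg a c = subst NonNegative (sym (⌜⌝-* a c)) _
  log : log₂ n ⌜ suc l ⌝
  log = _ , subst (2 ^ suc l <_) (sym (^-identityʳ n)) 2^l<n

-- An element of the left side is at most s t with s < 1/6 and t² ≤ u v ≤ n L ≤ (6h)². So t ≤ 6h and
-- s t < h, where h > 0 because n L > 0.
≼-lower : ∀ {n h L} → 0 < n → n ≤ 2 ^ L → 0 < L → n * L ≤ 6 * h * (6 * h) →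
          fromℚ (mkℚᵘ (ℤ.+ 1) 5) · √ (fromℕ n · log₂ n) ≼ fromℕ h
≼-lower {n} {zero} {L} 0<n n≤ 0<L nL≤ = contradiction (*-mono-≤ 0<n 0<L) (<⇒≱ (s≤s nL≤))
≼-lower {n} {h@(suc _)} {L} 0<n n≤ 0<L nL≤ q
  (q≥0 , s , t , (s≥0 , s<) , (t≥0 , _ , u , v , (u≥0 , u<n) , v∈log , t²≤uv) , q≤st) =
  q≥0 , ℚᵘ.≤-<-trans q≤st (ℚᵘ.≤-<-trans (ℚᵘ.*-monoʳ-≤-nonNeg s {{s≥0}} t≤6h)
    (ℚᵘ.<-respʳ-≃ sixth (ℚᵘ.*-monoˡ-<-pos ⌜ 6 * h ⌝ s<)))
  where
  t²≤ : t ℚᵘ.* t ℚᵘ.≤ ⌜ 6 * h ⌝ ℚᵘ.* ⌜ 6 * h ⌝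
  t²≤ = ℚᵘ.≤-trans t²≤uv (ℚᵘ.≤-trans
    (ℚᵘ.*-mono-≤-nonNeg {{u≥0}} {{proj₁ v∈log}} (ℚᵘ.<⇒≤ u<n) (ℚᵘ.<⇒≤ (log₂<⇒ n≤ v v∈log)))
    (subst₂ ℚᵘ._≤_ (sym (⌜⌝-* n L)) (sym (⌜⌝-* (6 * h) (6 * h))) (⌜⌝-mono-≤ nL≤)))
  t≤6h : t ℚᵘ.≤ ⌜ 6 * h ⌝
  t≤6h = ℚᵘ.≮⇒≥ λ 6h<t → ℚᵘ.<-irrefl ℚᵘ.≃-refl
    (ℚᵘ.<-≤-trans (ℚᵘ.*-mono-<-nonNeg 6h<t 6h<t) t²≤)
  sixth : mkℚᵘ (ℤ.+ 1) 5 ℚᵘ.* ⌜ 6 * h ⌝ ℚᵘ.≃ ⌜ h ⌝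
  sixth = *≡* (trans (ℤ.*-identityʳ _) (trans (ℤ.*-identityˡ (ℤ.+ (6 * h)))
    (trans (cong ℤ.+_ (*-comm 6 h)) (ℤ.pos-* h 6))))

h₂-lower : ∀ n → 2 ^ 9 < n → let h = h₂ n rrr,rrb (rrr,rrb-avoidable n) in
           ∃ λ L → n ≤ 2 ^ L × n * L ≤ 6 * h * (6 * h)
h₂-lower n n> = let c , c∈Forb , eq = proj₁ (proj₂ (∃h₂ n rrr,rrb (rrr,rrb-avoidable n))) in
  quadratic-bound (λ D ℓ large → subst (λ h → n * ℓ ≤ (D + h) * h) eq (Lower.h₂ᶜ-bound c c∈Forb D ℓ large)) n>

lemma2p5 : ((λ n → fromℕ (h₂ n rrr,rrb (rrr,rrb-avoidable n))) ∈Ω (λ n → √ (fromℕ n · log₂ n)))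
    × ((λ n → fromℕ (h₂ n rrr,rrb (rrr,rrb-avoidable n))) ∈O (λ n → √ (fromℕ n) · (log₂ n ^3/2)))
lemma2p5 =
  (mkℚᵘ (ℤ.+ 1) 5 , _ , suc (2 ^ 9) , λ n n> →
    let L , n≤ , nL≤ = h₂-lower n n> in
    ≼-lower (≤-trans (s≤s z≤n) n>) n≤ (L>0 n> n≤) nL≤) ,
  (mkℚᵘ (ℤ.+ suc (2 * 64 * 24)) 0 , _ , suc (2 ^ 10) , λ n n> →
    let s , l , s²<n , 2^l<n , c , c∈Forb , h≤ = h₂ᶜ-upper n n> in
    ≼-upper (2 * 64 * 24) s l s²<n 2^l<n (≤-trans
      (proj₂ (proj₂ (∃h₂ n rrr,rrb (rrr,rrb-avoidable n))) (h₂ᶜ c) (c , c∈Forb , refl)) h≤))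
  where
  L>0 : ∀ {n L} → 2 ^ 9 < n → n ≤ 2 ^ L → 0 < L
  L>0 {L = zero} n> n≤ = contradiction (≤-trans n> n≤) λ { (s≤s ()) }
  L>0 {L = suc _} _ _ = s≤s z≤n
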